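{- Let $(a_n)_{n\ge0}$ be the sequence, listed in increasing order, of the non-negative integers $m$ such that $240m+1$ is a perfect square. Then $$\sum_{n=0}^\infty(-1)^{\lfloor (n+2)/4\rfloor}q^{a_n}=\frac{(q,q^7,q^8;q^8)_\infty\,(q^6,q^{10};q^{16})_\infty}{(q,q^4;q^5)_\infty}.$$
   Context: Here $q$ is a complex number with $|q|<1$ (equivalently, the identity may be read as an identity of formal power series in $q$). For a complex number $a$, $(a;q)_\infty:=\prod_{i=0}^\infty(1-aq^i)$, and $(a_1,a_2,\dots,a_m;q)_\infty:=\prod_{j=1}^m(a_j;q)_\infty$. $\lfloor x\rfloor$ is the floor function. -}

module Defs where

open import Data.Nat as ℕ using (ℕ; zero; suc; _∸_; _/_; _<_; _≥_)
open import Data.Nat.Divisibility using (_∣?_)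
open import Data.Integer as ℤ using (ℤ; +_; -_)
open import Data.Product using (∃; _×_)
open import Relation.Nullary.Decidable using (Dec; yes; no)
open import Relation.Binary.PropositionalEquality using (_≡_)

-- Formal power series in q with integer coefficients: n ↦ coefficient of q^n.
Series : Set
Series = ℕ → ℤ

sumLt : ℕ → (ℕ → ℤ) → ℤ
sumLt zero    f = + 0
sumLt (suc n) f = sumLt n f ℤ.+ f n

δ : ℕ → ℕ → ℤ
δ m n with m ℕ.≟ n
... | yes _ = + 1
... | no  _ = + 0

_⊛_ : Series → Series → Series
(f ⊛ g) n = sumLt (suc n) (λ i → f i ℤ.* g (n ∸ i))

infixl 7 _⊛_

oneS : Series
oneS n = δ n 0

oneMinusQ : ℕ → Series
oneMinusQ e n = δ n 0 ℤ.- δ n e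

-- the series 1/(1 - q^e) = Σ_{j≥0} q^{j e}   (used only for e ≥ 1)
geomQ : ℕ → Series
geomQ e n with e ∣? n
... | yes _ = + 1
... | no  _ = + 0

finProd : (ℕ → Series) → ℕ → Series
finProd F zero    = oneS
finProd F (suc k) = finProd F k ⊛ F k

-- truncated q-Pochhammer:  ∏_{i<k} (1 - q^{a + b i}),  so (q^a;q^b)_∞ is its limit k → ∞
pochTr : ℕ → ℕ → ℕ → Series
pochTr a b k = finProd (λ i → oneMinusQ (a ℕ.+ b ℕ.* i)) k

pochInvTr : ℕ → ℕ → ℕ → Series
pochInvTr a b k = finProd (λ i → geomQ (a ℕ.+ b ℕ.* i)) k

rhsTr : ℕ → Series
rhsTr k = pochTr 1 8 k ⊛ pochTr 7 8 k ⊛ pochTr 8 8 k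
        ⊛ pochTr 6 16 k ⊛ pochTr 10 16 k
        ⊛ pochInvTr 1 5 k ⊛ pochInvTr 4 5 k

sgn : ℕ → ℤ
sgn n = (- (+ 1)) ℤ.^ ((n ℕ.+ 2) / 4)

lhsTr : (ℕ → ℕ) → ℕ → Series
lhsTr a k N = sumLt k (λ n → sgn n ℤ.* δ (a n) N)

IsA : ℕ → Set
IsA m = ∃ λ s → s ℕ.* s ≡ 240 ℕ.* m ℕ.+ 1

ListsIncreasing : (ℕ → Set) → (ℕ → ℕ) → Set
ListsIncreasing P a = (∀ m n → m < n → a m < a n) × (∀ m → P m → ∃ λ n → a n ≡ m) × (∀ n → P (a n))

{-# OPTIONS --safe #-}
module Submission where

-- Let Q_b = (q, q^(b−1), q^b; q^b)_∞ (q^(b−2), q^(b+2); q^(2b))_∞.  By the quintuple product identity,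
-- Q_b = Σ_{k∈ℤ} (q^(3k + bk(3k−1)/2) − q^(3k+1 + bk(3k+1)/2)).  The numerator of the right-hand side is Q_8.
-- Comparing exponents, Q_8(x²) is the even part of Q_4(x), and sorting the factors by residues gives
-- Q_4(x) = (x; x)_∞ = Q_5(x) (x², x⁸; x^10)_∞.  The last product is even in x, so taking even parts shows
-- that the right-hand side at q = x² is the even part of Q_5(x), whose exponents are those
-- (s² − 1)/120 with s² ≡ 1 (mod 240).
--
-- The quintuple product identity is the limit m → ∞ of the finite identity (z = −q, p = q^b)
--   Σ_{|k|≤m} (−1)^k z^(3k) p^(k(3k−1)/2) (1 + z p^k) (p;p)_{2m} / ((p, pz²; p)_{m+k} (p, p/z²; p)_{m−k})
--     = (1 + z) / (pz, p/z; p)_m,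
-- which follows by induction on m because the difference of consecutive cases telescopes in k.

-- Completing the square explains the choice of 4, 5 and 8. If e is an exponent of Q_b, then 24b·e +
-- (b-6)² is a square, namely of 6bk + 6 - b or of 6bk + 6 + b. So 24e+1 is a square for b = 4,
-- 48e+1 for b = 8 and 120e+1 for b = 5. Putting e = 2m turns 24 into 48 and 120 into 240, which is
-- why even parts connect Q_4 with Q_8 and Q_5 with the sequence. The telescoping function V is a
-- rational multiple of the summand, a certificate of Wilf-Zeilberger type; once the denominators
-- are cleared, checking it is a polynomial identity. As q is not invertible, the sum over k in ℤ is
-- kept as two sums over ℕ, and the certificate has separate cases for both halves, for the place
-- where they meet and for both ends.

open import Defs
open import Algebra.Bundles using (CommutativeRing; RawRing)
open import Algebra.Solver.Ring.AlmostCommutativeRing using (_-Raw-AlmostCommutative⟶_; fromCommutativeRing)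
open import Data.Fin as Fin using (Fin; #_; toℕ)
import Data.Fin.Properties as Fin
open import Data.Integer as ℤ using (ℤ; +_; -[1+_])
import Data.Integer.Properties as ℤ
import Data.Integer.Tactic.RingSolver as ℤSolver
open import Data.Maybe using (Maybe; just; nothing)
open import Data.Nat as ℕ using (ℕ; zero; suc; _∸_; _≤_; _<_; _≥_; z≤n; s≤s; _/_; _%_)
open import Data.Nat.Divisibility using (_∣?_; ∣m+n∣m⇒∣n; ∣m∣n⇒∣m+n; ∣-refl; ∣⇒≤; _∣0; divides)
open import Data.Nat.DivMod using (m≡m%n+[m/n]*n; m%n<n; +-distrib-/-∣ˡ; [m+kn]%n≡m%n)
import Data.Nat.Properties as ℕ
open import Data.Nat.Solver using (module +-*-Solver)
import Data.Nat.Tactic.RingSolver as ℕSolver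
open import Data.Product using (∃; _,_; proj₁; proj₂)
import Data.Sign as Sign
open import Data.Sum using (inj₁; inj₂)
open import Data.Vec using (Vec; []; _∷_)
open import Function using (_∘_; case_of_)
open import Level using (0ℓ)
open import Relation.Nullary using (yes; no; contradiction)
open import Relation.Nullary.Decidable using (toWitness; _→-dec_)
open import Relation.Binary.PropositionalEquality as ≡ using (_≡_; _≢_)
import Relation.Binary.Reasoning.Setoid as SetoidReasoning

-- Solving equations in a commutative ring with integer coefficients

module IntegerCoefficients {c ℓ} (R : CommutativeRing c ℓ) where

  open CommutativeRing R renaming (zero to *-zero)
  open import Algebra.Definitions.RawMonoid +-rawMonoid using () renaming (_×′_ to _×_)
  open import Algebra.Properties.Ring ring using (-‿distribˡ-*; -‿distribʳ-*; -0#≈0#; -‿involutive)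
  open import Algebra.Properties.AbelianGroup +-abelianGroup using (⁻¹-∙-comm)
  open import Algebra.Properties.Semiring.Mult.TCOptimised semiring using (1+×; ×-homo-+; ×1-homo-*)
  open SetoidReasoning setoid

  -- With _×′_ the literal 1 is interpreted as 1# definitionally.
  fromℤ : ℤ → Carrier
  fromℤ (+ n)    = n × 1#
  fromℤ -[1+ n ] = - (suc n × 1#)

  fromℤ-⊖ : ∀ m n → fromℤ (m ℤ.⊖ n) ≈ m × 1# + - (n × 1#)
  fromℤ-⊖ zero    zero    = sym (-‿inverseʳ 0#)
  fromℤ-⊖ zero    (suc n) = sym (+-identityˡ _)
  fromℤ-⊖ (suc m) zero    = sym (trans (+-congˡ -0#≈0#) (+-identityʳ _))
  fromℤ-⊖ (suc m) (suc n) = begin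
    fromℤ (suc m ℤ.⊖ suc n)                      ≡⟨ ≡.cong fromℤ (ℤ.[1+m]⊖[1+n]≡m⊖n m n) ⟩
    fromℤ (m ℤ.⊖ n)                              ≈⟨ fromℤ-⊖ m n ⟩
    m × 1# + - (n × 1#)                          ≈⟨ +-congʳ (+-identityʳ _) ⟨
    m × 1# + 0# + - (n × 1#)                     ≈⟨ +-congʳ (+-congˡ (-‿inverseʳ 1#)) ⟨
    m × 1# + (1# + - 1#) + - (n × 1#)            ≈⟨ +-congʳ (+-assoc _ _ _) ⟨
    m × 1# + 1# + - 1# + - (n × 1#)              ≈⟨ +-assoc _ _ _ ⟩
    m × 1# + 1# + (- 1# + - (n × 1#))            ≈⟨ +-cong (trans (+-comm _ _) (sym (1+× m 1#))) (⁻¹-∙-comm 1# (n × 1#)) ⟩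
    suc m × 1# + - (1# + n × 1#)                 ≈⟨ +-congˡ (-‿cong (1+× n 1#)) ⟨
    suc m × 1# + - (suc n × 1#)                  ∎

  fromℤ-+ : ∀ i j → fromℤ (i ℤ.+ j) ≈ fromℤ i + fromℤ j
  fromℤ-+ (+ m)    (+ n)    = ×-homo-+ 1# m n
  fromℤ-+ (+ m)    -[1+ n ] = fromℤ-⊖ m (suc n)
  fromℤ-+ -[1+ m ] (+ n)    = trans (fromℤ-⊖ n (suc m)) (+-comm _ _)
  fromℤ-+ -[1+ m ] -[1+ n ] = begin
    - (suc (suc (m ℕ.+ n)) × 1#)       ≈⟨ -‿cong (1+× (suc (m ℕ.+ n)) 1#) ⟩
    - (1# + suc (m ℕ.+ n) × 1#)        ≈⟨ -‿cong (+-congˡ (×-homo-+ 1# (suc m) n)) ⟩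
    - (1# + (suc m × 1# + n × 1#))     ≈⟨ -‿cong (trans (sym (+-assoc _ _ _)) (trans (+-congʳ (+-comm _ _)) (+-assoc _ _ _))) ⟩
    - (suc m × 1# + (1# + n × 1#))     ≈⟨ -‿cong (+-congˡ (1+× n 1#)) ⟨
    - (suc m × 1# + suc n × 1#)        ≈⟨ ⁻¹-∙-comm _ _ ⟨
    - (suc m × 1#) + - (suc n × 1#)    ∎

  fromℤ-+◃ : ∀ n → fromℤ (Sign.+ ℤ.◃ n) ≈ n × 1#
  fromℤ-+◃ zero    = refl
  fromℤ-+◃ (suc n) = refl

  fromℤ--◃ : ∀ n → fromℤ (Sign.- ℤ.◃ n) ≈ - (n × 1#)
  fromℤ--◃ zero    = sym -0#≈0#
  fromℤ--◃ (suc n) = refl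

  fromℤ-* : ∀ i j → fromℤ (i ℤ.* j) ≈ fromℤ i * fromℤ j
  fromℤ-* (+ m)    (+ n)    = trans (fromℤ-+◃ (m ℕ.* n)) (×1-homo-* m n)
  fromℤ-* (+ m)    -[1+ n ] = trans (fromℤ--◃ (m ℕ.* suc n)) (trans (-‿cong (×1-homo-* m (suc n))) (-‿distribʳ-* _ _))
  fromℤ-* -[1+ m ] (+ n)    = trans (fromℤ--◃ (suc m ℕ.* n)) (trans (-‿cong (×1-homo-* (suc m) n)) (-‿distribˡ-* _ _))
  fromℤ-* -[1+ m ] -[1+ n ] = begin
    (suc m ℕ.* suc n) × 1#                 ≈⟨ ×1-homo-* (suc m) (suc n) ⟩
    (suc m × 1#) * (suc n × 1#)            ≈⟨ -‿involutive _ ⟨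
    - - ((suc m × 1#) * (suc n × 1#))      ≈⟨ -‿cong (-‿distribʳ-* _ _) ⟩
    - ((suc m × 1#) * - (suc n × 1#))      ≈⟨ -‿distribˡ-* _ _ ⟩
    - (suc m × 1#) * - (suc n × 1#)        ∎

  fromℤ-neg : ∀ i → fromℤ (ℤ.- i) ≈ - fromℤ i
  fromℤ-neg (+ zero)  = sym -0#≈0#
  fromℤ-neg (+ suc n) = refl
  fromℤ-neg -[1+ n ]  = sym (-‿involutive _)

  ℤ-rawRing : RawRing 0ℓ 0ℓ
  ℤ-rawRing = CommutativeRing.rawRing ℤ.+-*-commutativeRing

  fromℤ-hom : ℤ-rawRing -Raw-AlmostCommutative⟶ fromCommutativeRing R
  fromℤ-hom = record
    { ⟦_⟧    = fromℤ
    ; +-homo = fromℤ-+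
    ; *-homo = fromℤ-*
    ; -‿homo = fromℤ-neg
    ; 0-homo = refl
    ; 1-homo = refl
    }

  -- Terms cancel in the solver only if equal coefficients are recognised. Integers can be compared,
  -- whereas equality in R comes with no decision procedure.
  fromℤ-≟ : ∀ i j → Maybe (fromℤ i ≈ fromℤ j)
  fromℤ-≟ i j with i ℤ.≟ j
  ... | yes ≡.refl = just refl
  ... | no _       = nothing

  open import Algebra.Solver.Ring ℤ-rawRing (fromCommutativeRing R) fromℤ-hom fromℤ-≟ public
    using (Polynomial; con; _:+_; _:*_; _:-_; :-_; _:=_; solve)

-- The telescoping certificate

module Certificate {c ℓ} (R : CommutativeRing c ℓ) where

  open CommutativeRing R
  open IntegerCoefficients R

  -- The telescoping functions at indices k ≥ 0 and −(k+1), without their power of q and q-factorial factors;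
  -- here y = q, p = q^b, a = p^k, B = p^(m−k), so that p * a * B = p^(m+1).
  cert⁺ cert⁻ : (y p a B : Carrier) → Carrier
  cert⁺ y p a B = - (y * a * a * (p * a * B) *
    (1# + y * y + y * (p * a * B) - y * p * p * a * a * a * B * B * B - y * y * (p * a * B) * a - B))
  cert⁻ y p a B = - (y * B *
    (1# + y * y + y * (p * a * B) - y * p * p * a * a * a * B * B * B - y * y * B - p * a * a * B))

  cert⁺-cong : ∀ {y p a a′ B B′} → a ≈ a′ → B ≈ B′ → cert⁺ y p a B ≈ cert⁺ y p a′ B′
  cert⁺-cong a≈ B≈ = -‿cong (*-cong (*-cong (*-cong (*-congˡ a≈) a≈) M≈)
    (+-cong (+-cong (+-cong (+-congˡ (*-congˡ M≈))
      (-‿cong (*-cong (*-cong (*-cong (*-cong (*-cong (*-congˡ a≈) a≈) a≈) B≈) B≈) B≈)))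
      (-‿cong (*-cong (*-congˡ M≈) a≈))) (-‿cong B≈)))
    where M≈ = *-cong (*-congˡ a≈) B≈

  cert⁻-cong : ∀ {y p a a′ B B′} → a ≈ a′ → B ≈ B′ → cert⁻ y p a B ≈ cert⁻ y p a′ B′
  cert⁻-cong a≈ B≈ = -‿cong (*-cong (*-congˡ B≈)
    (+-cong (+-cong (+-cong (+-congˡ (*-congˡ (*-cong (*-congˡ a≈) B≈)))
      (-‿cong (*-cong (*-cong (*-cong (*-cong (*-cong (*-congˡ a≈) a≈) a≈) B≈) B≈) B≈)))
      (-‿cong (*-congˡ B≈))) (-‿cong (*-cong (*-cong (*-congˡ a≈) a≈) B≈))))

  1-cong : ∀ {x x′} → x ≈ x′ → 1# - x ≈ 1# - x′
  1-cong x≈ = +-congˡ (-‿cong x≈)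

  factors : ∀ {G G′ x x′ z z′} → G ≈ G′ * ((1# - x) * (1# - z)) → x ≈ x′ → z ≈ z′ → G ≈ G′ * ((1# - x′) * (1# - z′))
  factors G≈ x≈ z≈ = trans G≈ (*-congˡ (*-cong (1-cong x≈) (1-cong z≈)))

  next-cong : ∀ {x₁ x₂ x₃ x₄ x₁′ x₂′ x₃′ x₄′ T T′ P G} →
    x₁ ≈ x₁′ → x₂ ≈ x₂′ → x₃ ≈ x₃′ → x₄ ≈ x₄′ → T ≈ T′ →
    (1# + x₁) * (1# + x₂) * (T * (P * (1# - x₃) * (1# - x₄) * G)) ≈
    (1# + x₁′) * (1# + x₂′) * (T′ * (P * (1# - x₃′) * (1# - x₄′) * G))
  next-cong x₁≈ x₂≈ x₃≈ x₄≈ T≈ = *-cong (*-cong (+-congˡ x₁≈) (+-congˡ x₂≈))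
    (*-cong T≈ (*-congʳ (*-cong (*-congˡ (1-cong x₃≈)) (1-cong x₄≈))))

  module Poly {n : ℕ} where
    𝟙 : Polynomial n
    𝟙 = con (+ 1)
    certP⁺ certP⁻ : (y p a B : Polynomial n) → Polynomial n
    certP⁺ y p a B = :- (y :* a :* a :* (p :* a :* B) :*
      (𝟙 :+ y :* y :+ y :* (p :* a :* B) :- y :* p :* p :* a :* a :* a :* B :* B :* B :- y :* y :* (p :* a :* B) :* a :- B))
    certP⁻ y p a B = :- (y :* B :*
      (𝟙 :+ y :* y :+ y :* (p :* a :* B) :- y :* p :* p :* a :* a :* a :* B :* B :* B :- y :* y :* B :- p :* a :* a :* B))
    nextP : (x₁ x₂ x₃ x₄ T P G : Polynomial n) → Polynomial n
    nextP x₁ x₂ x₃ x₄ T P G = (𝟙 :+ x₁) :* (𝟙 :+ x₂) :* (T :* (P :* (𝟙 :- x₃) :* (𝟙 :- x₄) :* G))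
  open Poly

  module _ {y x : Carrier} {P Gp Gm x₁ x₂ x₃ x₄ : Carrier} where

    private
      r = y * x
      p = y * y * r

    -- The step from index k to k + 1 for k ≥ 0, with `a` = p^k, `L` = p^(m-k-1), `M` = p^(m+1), `x`
    -- = q^(b-3) and `r` = q^(b-2). Each power of q is a variable with an equation reducing it to a
    -- few independent ones, and inverse products of lower index are those of higher index times
    -- polynomial factors. What remains is a polynomial identity without division, valid in every
    -- commutative ring.
    pos-step : ∀ {a a′ L B τ τ′ z Gp′ Gm′ g₁ g₂ g₃ g₄} →
      let M = p * (p * a) * L in
      a′ ≈ p * a → B ≈ p * L → τ′ ≈ τ * (y * y * y * p * a * a * a) → z ≈ y * (p * a) →
      x₁ ≈ y * M → x₂ ≈ y * r * (p * a) * L → x₃ ≈ p * (p * a) * (p * a) * L * L → x₄ ≈ M * M →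
      Gp′ ≈ Gp * ((1# - g₁) * (1# - g₂)) → g₁ ≈ M * (p * a) → g₂ ≈ M * (p * a) * y * y →
      Gm′ ≈ Gm * ((1# - g₃) * (1# - g₄)) → g₃ ≈ p * L → g₄ ≈ r * L →
      (1# + x₁) * (1# + x₂) * (τ′ * (1# - z) * (P * (1# - x₃) * (1# - x₄) * (Gp * Gm)))
        - τ′ * (1# - z) * (P * (Gp′ * Gm′))
      ≈ τ′ * cert⁺ y p a′ L * (P * (Gp * Gm′)) - τ * cert⁺ y p a B * (P * (Gp′ * Gm))
    pos-step {a} {a′} {L} {B} {τ} a′≈ B≈ τ′≈ z≈ x₁≈ x₂≈ x₃≈ x₄≈ Gp′≈ g₁≈ g₂≈ Gm′≈ g₃≈ g₄≈ = trans
      (+-cong (next-cong x₁≈ x₂≈ x₃≈ x₄≈ T≈) (-‿cong (*-cong T≈ (*-congˡ (*-cong Gp≈ Gm≈)))))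
      (trans (polynomial y r a L τ P Gp Gm)
        (sym (+-cong (*-cong (*-cong τ′≈ (cert⁺-cong a′≈ refl)) (*-congˡ (*-congˡ Gm≈)))
          (-‿cong (*-cong (*-congˡ (cert⁺-cong refl B≈)) (*-congˡ (*-congʳ Gp≈)))))))
      where
      T≈  = *-cong τ′≈ (1-cong z≈)
      Gp≈ = factors Gp′≈ g₁≈ g₂≈
      Gm≈ = factors Gm′≈ g₃≈ g₄≈
      polynomial = solve 8 (λ y r a L τ P Gp Gm →
        let p   = y :* y :* r
            a′  = p :* a
            τ′  = τ :* (y :* y :* y :* p :* a :* a :* a)
            M   = p :* a′ :* L
            T   = τ′ :* (𝟙 :- y :* a′)
            Gp′ = Gp :* ((𝟙 :- M :* a′) :* (𝟙 :- M :* a′ :* y :* y))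
            Gm′ = Gm :* ((𝟙 :- p :* L) :* (𝟙 :- r :* L))
        in nextP (y :* M) (y :* r :* a′ :* L) (p :* a′ :* a′ :* L :* L) (M :* M) T P (Gp :* Gm)
             :- T :* (P :* (Gp′ :* Gm′))
           := τ′ :* certP⁺ y p a′ L :* (P :* (Gp :* Gm′)) :- τ :* certP⁺ y p a (p :* L) :* (P :* (Gp′ :* Gm)))
        refl

    -- Index m + 1 occurs only in the sum for m + 1, and the telescoping function counts as 0 there,
    -- so only its value at m is left; here `a` = p^m.
    pos-end : ∀ {a B τ τ′ z Gp′ g₁ g₂} →
      let M = p * a in
      B ≈ 1# → τ′ ≈ τ * (y * y * y * p * a * a * a) → z ≈ y * (p * a) →
      x₁ ≈ y * M → x₂ ≈ y * r * a → x₃ ≈ p * a * a → x₄ ≈ M * M →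
      Gp′ ≈ Gp * ((1# - g₁) * (1# - g₂)) → g₁ ≈ M * M → g₂ ≈ M * M * y * y →
      (1# + x₁) * (1# + x₂) * (τ′ * (1# - z) * (P * (1# - x₃) * (1# - x₄) * (Gp * Gm)))
      ≈ - (τ * cert⁺ y p a B * (P * (Gp′ * Gm)))
    pos-end {a} {B} {τ} B≈ τ′≈ z≈ x₁≈ x₂≈ x₃≈ x₄≈ Gp′≈ g₁≈ g₂≈ = trans
      (next-cong x₁≈ x₂≈ x₃≈ x₄≈ (*-cong τ′≈ (1-cong z≈)))
      (trans (polynomial y r a τ P Gp Gm)
        (sym (-‿cong (*-cong (*-congˡ (cert⁺-cong refl B≈)) (*-congˡ (*-congʳ (factors Gp′≈ g₁≈ g₂≈)))))))
      where
      polynomial = solve 7 (λ y r a τ P Gp Gm →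
        let p   = y :* y :* r
            τ′  = τ :* (y :* y :* y :* p :* a :* a :* a)
            M   = p :* a
            T   = τ′ :* (𝟙 :- y :* M)
            Gp′ = Gp :* ((𝟙 :- M :* M) :* (𝟙 :- M :* M :* y :* y))
        in nextP (y :* M) (y :* r :* a) (p :* a :* a) (M :* M) T P (Gp :* Gm)
           := :- (τ :* certP⁺ y p a 𝟙 :* (P :* (Gp′ :* Gm))))
        refl

    -- The two halves meet here: the predecessor of index 0 is -1, the first index of the negative
    -- half, hence `cert⁻` on the right.
    pos-start : ∀ {a₀ B τ₀ σ₀ z Gp′ Gm′ g₁ g₂ g₃ g₄} →
      let M = p * B in
      a₀ ≈ 1# → τ₀ ≈ 1# → σ₀ ≈ x → z ≈ y →
      x₁ ≈ y * M → x₂ ≈ y * r * B → x₃ ≈ p * B * B → x₄ ≈ M * M →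
      Gp′ ≈ Gp * ((1# - g₁) * (1# - g₂)) → g₁ ≈ M → g₂ ≈ M * y * y →
      Gm′ ≈ Gm * ((1# - g₃) * (1# - g₄)) → g₃ ≈ M → g₄ ≈ r * B →
      (1# + x₁) * (1# + x₂) * (τ₀ * (1# - z) * (P * (1# - x₃) * (1# - x₄) * (Gp * Gm)))
        - τ₀ * (1# - z) * (P * (Gp′ * Gm′))
      ≈ τ₀ * cert⁺ y p a₀ B * (P * (Gp * Gm′)) - σ₀ * cert⁻ y p a₀ B * (P * (Gp′ * Gm))
    pos-start {a₀} {B} a₀≈ τ₀≈ σ₀≈ z≈ x₁≈ x₂≈ x₃≈ x₄≈ Gp′≈ g₁≈ g₂≈ Gm′≈ g₃≈ g₄≈ = trans
      (+-cong (next-cong x₁≈ x₂≈ x₃≈ x₄≈ T≈) (-‿cong (*-cong T≈ (*-congˡ (*-cong Gp≈ Gm≈)))))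
      (trans (polynomial y x B P Gp Gm)
        (sym (+-cong (*-cong (*-cong τ₀≈ (cert⁺-cong a₀≈ refl)) (*-congˡ (*-congˡ Gm≈)))
          (-‿cong (*-cong (*-cong σ₀≈ (cert⁻-cong a₀≈ refl)) (*-congˡ (*-congʳ Gp≈)))))))
      where
      T≈  = *-cong τ₀≈ (1-cong z≈)
      Gp≈ = factors Gp′≈ g₁≈ g₂≈
      Gm≈ = factors Gm′≈ g₃≈ g₄≈
      polynomial = solve 6 (λ y x B P Gp Gm →
        let r   = y :* x
            p   = y :* y :* r
            M   = p :* B
            T   = 𝟙 :* (𝟙 :- y)
            Gp′ = Gp :* ((𝟙 :- M) :* (𝟙 :- M :* y :* y))
            Gm′ = Gm :* ((𝟙 :- M) :* (𝟙 :- r :* B))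
        in nextP (y :* M) (y :* r :* B) (p :* B :* B) (M :* M) T P (Gp :* Gm)
             :- T :* (P :* (Gp′ :* Gm′))
           := 𝟙 :* certP⁺ y p 𝟙 B :* (P :* (Gp :* Gm′)) :- x :* certP⁻ y p 𝟙 B :* (P :* (Gp′ :* Gm)))
        refl

    -- Here the index is -(k+1) and `a` = p^k. Its predecessor is -(k+2), so the difference runs
    -- opposite to `pos-step`. The ratio of successive powers contains q^(b-3), which makes `x`
    -- rather than `r` the independent variable.
    neg-step : ∀ {a a′ L B σ σ′ Gp′ Gm′ g₁ g₂ g₃ g₄} →
      let M = p * (p * a) * L in
      a′ ≈ p * a → B ≈ p * L → σ′ ≈ σ * (x * (p * a) * (p * a) * (p * a)) →
      x₁ ≈ y * M → x₂ ≈ y * r * (p * a) * L → x₃ ≈ p * (p * a) * (p * a) * L * L → x₄ ≈ M * M →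
      Gp′ ≈ Gp * ((1# - g₁) * (1# - g₂)) → g₁ ≈ p * L → g₂ ≈ p * L * y * y →
      Gm′ ≈ Gm * ((1# - g₃) * (1# - g₄)) → g₃ ≈ M * (p * a) → g₄ ≈ r * (p * a) * (p * a) * L →
      (1# + x₁) * (1# + x₂) * (σ * (a′ - y) * (P * (1# - x₃) * (1# - x₄) * (Gp * Gm)))
        - σ * (a′ - y) * (P * (Gp′ * Gm′))
      ≈ σ * cert⁻ y p a B * (P * (Gp * Gm′)) - σ′ * cert⁻ y p a′ L * (P * (Gp′ * Gm))
    neg-step {a} {a′} {L} {B} {σ} a′≈ B≈ σ′≈ x₁≈ x₂≈ x₃≈ x₄≈ Gp′≈ g₁≈ g₂≈ Gm′≈ g₃≈ g₄≈ = trans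
      (+-cong (next-cong x₁≈ x₂≈ x₃≈ x₄≈ T≈) (-‿cong (*-cong T≈ (*-congˡ (*-cong Gp≈ Gm≈)))))
      (trans (polynomial y x a L σ P Gp Gm)
        (sym (+-cong (*-cong (*-congˡ (cert⁻-cong refl B≈)) (*-congˡ (*-congˡ Gm≈)))
          (-‿cong (*-cong (*-cong σ′≈ (cert⁻-cong a′≈ refl)) (*-congˡ (*-congʳ Gp≈)))))))
      where
      T≈  = *-congˡ (+-congʳ a′≈)
      Gp≈ = factors Gp′≈ g₁≈ g₂≈
      Gm≈ = factors Gm′≈ g₃≈ g₄≈
      polynomial = solve 8 (λ y x a L σ P Gp Gm →
        let r   = y :* x
            p   = y :* y :* r
            a′  = p :* a
            σ′  = σ :* (x :* a′ :* a′ :* a′)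
            M   = p :* a′ :* L
            T   = σ :* (a′ :- y)
            Gp′ = Gp :* ((𝟙 :- p :* L) :* (𝟙 :- p :* L :* y :* y))
            Gm′ = Gm :* ((𝟙 :- M :* a′) :* (𝟙 :- r :* a′ :* a′ :* L))
        in nextP (y :* M) (y :* r :* a′ :* L) (p :* a′ :* a′ :* L :* L) (M :* M) T P (Gp :* Gm)
             :- T :* (P :* (Gp′ :* Gm′))
           := σ :* certP⁻ y p a (p :* L) :* (P :* (Gp :* Gm′)) :- σ′ :* certP⁻ y p a′ L :* (P :* (Gp′ :* Gm)))
        refl

    neg-end : ∀ {a a′ B σ Gm′ g₃ g₄} →
      let M = p * a in
      a′ ≈ p * a → B ≈ 1# →
      x₁ ≈ y * M → x₂ ≈ y * r * a → x₃ ≈ p * a * a → x₄ ≈ M * M →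
      Gm′ ≈ Gm * ((1# - g₃) * (1# - g₄)) → g₃ ≈ M * M → g₄ ≈ r * p * a * a →
      (1# + x₁) * (1# + x₂) * (σ * (a′ - y) * (P * (1# - x₃) * (1# - x₄) * (Gp * Gm)))
      ≈ σ * cert⁻ y p a B * (P * (Gp * Gm′))
    neg-end {a} {a′} {B} {σ} a′≈ B≈ x₁≈ x₂≈ x₃≈ x₄≈ Gm′≈ g₃≈ g₄≈ = trans
      (next-cong x₁≈ x₂≈ x₃≈ x₄≈ (*-congˡ (+-congʳ a′≈)))
      (trans (polynomial y r a σ P Gp Gm)
        (sym (*-cong (*-congˡ (cert⁻-cong refl B≈)) (*-congˡ (*-congˡ (factors Gm′≈ g₃≈ g₄≈))))))
      where
      polynomial = solve 7 (λ y r a σ P Gp Gm →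
        let p   = y :* y :* r
            M   = p :* a
            T   = σ :* (M :- y)
            Gm′ = Gm :* ((𝟙 :- M :* M) :* (𝟙 :- r :* p :* a :* a))
        in nextP (y :* M) (y :* r :* a) (p :* a :* a) (M :* M) T P (Gp :* Gm)
           := σ :* certP⁻ y p a 𝟙 :* (P :* (Gp :* Gm′)))
        refl

-- Truncated infinite products

-- The ring is kept abstract; it stands for ℤ[[q]]/(q^(N+1)), X e for q^e and inv e for 1/(1 − q^e).
record TruncatedPowers (R : CommutativeRing 0ℓ 0ℓ) (N : ℕ) : Set where
  open CommutativeRing R
  field
    X        : ℕ → Carrier
    X-0      : X 0 ≈ 1#
    X-+      : ∀ d e → X (d ℕ.+ e) ≈ X d * X e
    X-high   : ∀ {e} → N < e → X e ≈ 0#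
    inv      : ℕ → Carrier
    inv-step : ∀ e → 0 < e → inv e ≈ 1# + X e * inv e

*-1- : ∀ {c ℓ} (R : CommutativeRing c ℓ) → let open CommutativeRing R in ∀ f x → f * (1# - x) ≈ f - x * f
*-1- R f x = solve 2 (λ f x → f :* (con (+ 1) :- x) := f :- x :* f) (CommutativeRing.refl R) f x
  where open IntegerCoefficients R

module Products {R : CommutativeRing 0ℓ 0ℓ} {N : ℕ} (S : TruncatedPowers R N) where

  open CommutativeRing R
  open TruncatedPowers S
  open import Algebra.Properties.CommutativeSemigroup *-commutativeSemigroup using () renaming (interchange to *-interchange)
  open import Algebra.Properties.Ring ring using (-0#≈0#)
  open SetoidReasoning setoid

  ∏ ∑ : (ℕ → Carrier) → ℕ → Carrier
  ∏ F zero    = 1#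
  ∏ F (suc k) = ∏ F k * F k
  ∑ F zero    = 0#
  ∑ F (suc k) = ∑ F k + F k

  ∏-cong : ∀ {F G : ℕ → Carrier} k → (∀ i → F i ≈ G i) → ∏ F k ≈ ∏ G k
  ∏-cong zero    eq = refl
  ∏-cong (suc k) eq = *-cong (∏-cong k eq) (eq k)

  ∏-* : ∀ (F G : ℕ → Carrier) k → ∏ (λ i → F i * G i) k ≈ ∏ F k * ∏ G k
  ∏-* F G zero    = sym (*-identityˡ 1#)
  ∏-* F G (suc k) = trans (*-congʳ (∏-* F G k)) (*-interchange (∏ F k) (∏ G k) (F k) (G k))

  ∏-1 : ∀ k → ∏ (λ _ → 1#) k ≈ 1#
  ∏-1 zero    = refl
  ∏-1 (suc k) = trans (*-identityʳ _) (∏-1 k)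

  ∏-append : ∀ (F : ℕ → Carrier) m n → ∏ F (m ℕ.+ n) ≈ ∏ F m * ∏ (λ i → F (m ℕ.+ i)) n
  ∏-append F m zero    rewrite ℕ.+-identityʳ m = sym (*-identityʳ _)
  ∏-append F m (suc n) rewrite ℕ.+-suc m n = trans (*-congʳ (∏-append F m n)) (*-assoc _ _ _)

  ∏-extend : ∀ (F : ℕ → Carrier) m n → (∀ i → m ≤ i → F i ≈ 1#) → ∏ F (m ℕ.+ n) ≈ ∏ F m
  ∏-extend F m n eq = begin
    ∏ F (m ℕ.+ n)                        ≈⟨ ∏-append F m n ⟩
    ∏ F m * ∏ (λ i → F (m ℕ.+ i)) n      ≈⟨ *-congˡ (trans (∏-cong n (λ i → eq (m ℕ.+ i) (ℕ.m≤m+n m i))) (∏-1 n)) ⟩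
    ∏ F m * 1#                           ≈⟨ *-identityʳ _ ⟩
    ∏ F m                                ∎

  ∏-stable : ∀ (F : ℕ → Carrier) m n → (∀ i → m ≤ i → F i ≈ 1#) → (∀ i → n ≤ i → F i ≈ 1#) → ∏ F m ≈ ∏ F n
  ∏-stable F m n eqₘ eqₙ = begin
    ∏ F m           ≈⟨ ∏-extend F m n eqₘ ⟨
    ∏ F (m ℕ.+ n)   ≡⟨ ≡.cong (∏ F) (ℕ.+-comm m n) ⟩
    ∏ F (n ℕ.+ m)   ≈⟨ ∏-extend F n m eqₙ ⟩
    ∏ F n           ∎

  ∏-residues : ∀ (F : ℕ → Carrier) c k → ∏ F (k ℕ.* c) ≈ ∏ (λ r → ∏ (λ i → F (i ℕ.* c ℕ.+ r)) k) c
  ∏-residues F c zero    = sym (∏-1 c)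
  ∏-residues F c (suc k) = begin
    ∏ F (c ℕ.+ k ℕ.* c)                                                             ≡⟨ ≡.cong (∏ F) (ℕ.+-comm c (k ℕ.* c)) ⟩
    ∏ F (k ℕ.* c ℕ.+ c)                                                             ≈⟨ ∏-append F (k ℕ.* c) c ⟩
    ∏ F (k ℕ.* c) * ∏ (λ r → F (k ℕ.* c ℕ.+ r)) c                                   ≈⟨ *-congʳ (∏-residues F c k) ⟩
    ∏ (λ r → ∏ (λ i → F (i ℕ.* c ℕ.+ r)) k) c * ∏ (λ r → F (k ℕ.* c ℕ.+ r)) c       ≈⟨ ∏-* _ _ c ⟨
    ∏ (λ r → ∏ (λ i → F (i ℕ.* c ℕ.+ r)) (suc k)) c                                 ∎

  ∑-cong : ∀ n {F G : ℕ → Carrier} → (∀ i → i < n → F i ≈ G i) → ∑ F n ≈ ∑ G n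
  ∑-cong zero    eq = refl
  ∑-cong (suc n) eq = +-cong (∑-cong n (λ i i<n → eq i (ℕ.m<n⇒m<1+n i<n))) (eq n ℕ.≤-refl)

  ∑-*ʳ : ∀ (F : ℕ → Carrier) n g → ∑ F n * g ≈ ∑ (λ i → F i * g) n
  ∑-*ʳ F zero    g = zeroˡ g
  ∑-*ʳ F (suc n) g = trans (distribʳ g (∑ F n) (F n)) (+-congʳ (∑-*ʳ F n g))

  ∑-extend : ∀ (F : ℕ → Carrier) m n → (∀ i → m ≤ i → F i ≈ 0#) → ∑ F (m ℕ.+ n) ≈ ∑ F m
  ∑-extend F m zero    eq rewrite ℕ.+-identityʳ m = refl
  ∑-extend F m (suc n) eq rewrite ℕ.+-suc m n = trans (+-cong (∑-extend F m n eq) (eq (m ℕ.+ n) (ℕ.m≤m+n m n))) (+-identityʳ _)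

  ∑-stable : ∀ (F : ℕ → Carrier) {m n} → (∀ i → m ≤ i → F i ≈ 0#) → (∀ i → n ≤ i → F i ≈ 0#) → ∑ F m ≈ ∑ F n
  ∑-stable F {m} {n} eqₘ eqₙ = begin
    ∑ F m           ≈⟨ ∑-extend F m n eqₘ ⟨
    ∑ F (m ℕ.+ n)   ≡⟨ ≡.cong (∑ F) (ℕ.+-comm m n) ⟩
    ∑ F (n ℕ.+ m)   ≈⟨ ∑-extend F n m eqₙ ⟩
    ∑ F n           ∎

  1-X-high : ∀ {e} → N < e → 1# - X e ≈ 1#
  1-X-high N<e = trans (+-congˡ (trans (-‿cong (X-high N<e)) -0#≈0#)) (+-identityʳ 1#)

  inv-1-X : ∀ e → 0 < e → inv e * (1# - X e) ≈ 1#
  inv-1-X e 0<e = begin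
    inv e * (1# - X e)                  ≈⟨ *-1- R (inv e) (X e) ⟩
    inv e - X e * inv e                 ≈⟨ +-congʳ (inv-step e 0<e) ⟩
    1# + X e * inv e - X e * inv e      ≈⟨ trans (+-assoc _ _ _) (trans (+-congˡ (-‿inverseʳ _)) (+-identityʳ 1#)) ⟩
    1#                                  ∎

  inv-high : ∀ {e} → N < e → inv e ≈ 1#
  inv-high {e} N<e = trans (sym (*-identityʳ (inv e))) (trans (*-congˡ (sym (1-X-high N<e))) (inv-1-X e (ℕ.≤-<-trans z≤n N<e)))

  poch pochInv : ℕ → ℕ → ℕ → Carrier
  poch    a b = ∏ (λ i → 1# - X (a ℕ.+ b ℕ.* i))
  pochInv a b = ∏ (λ i → inv (a ℕ.+ b ℕ.* i))

  exponent-high : ∀ a b i → 0 < b → N < i → N < a ℕ.+ b ℕ.* i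
  exponent-high a (suc b) i _ N<i = ℕ.<-≤-trans N<i (ℕ.≤-trans (ℕ.m≤m+n i (b ℕ.* i)) (ℕ.m≤n+m _ a))

  -- Factors of index above N have exponent above N and equal 1 modulo q^(N+1). Any number of
  -- factors exceeding N therefore represents the infinite product exactly.
  poch-stable : ∀ a b {m n} → 0 < b → N < m → N < n → poch a b m ≈ poch a b n
  poch-stable a b {m} {n} 0<b N<m N<n = ∏-stable _ m n
    (λ i m≤i → 1-X-high (exponent-high a b i 0<b (ℕ.<-≤-trans N<m m≤i)))
    (λ i n≤i → 1-X-high (exponent-high a b i 0<b (ℕ.<-≤-trans N<n n≤i)))

  pochInv-stable : ∀ a b {m n} → 0 < b → N < m → N < n → pochInv a b m ≈ pochInv a b n
  pochInv-stable a b {m} {n} 0<b N<m N<n = ∏-stable _ m n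
    (λ i m≤i → inv-high (exponent-high a b i 0<b (ℕ.<-≤-trans N<m m≤i)))
    (λ i n≤i → inv-high (exponent-high a b i 0<b (ℕ.<-≤-trans N<n n≤i)))

  pochInv-poch : ∀ a b k → 0 < a → pochInv a b k * poch a b k ≈ 1#
  pochInv-poch a b k 0<a = trans (sym (∏-* _ _ k))
    (trans (∏-cong k (λ i → inv-1-X (a ℕ.+ b ℕ.* i) (ℕ.<-≤-trans 0<a (ℕ.m≤m+n a (b ℕ.* i))))) (∏-1 k))

  poch-residues : ∀ a b c k → poch a b (k ℕ.* c) ≈ ∏ (λ r → poch (a ℕ.+ b ℕ.* r) (b ℕ.* c) k) c
  poch-residues a b c k = trans (∏-residues _ c k)
    (∏-cong c (λ r → ∏-cong k (λ i → +-congˡ (-‿cong (reflexive (≡.cong X (eq a b c r i)))))))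
    where
    eq : ∀ a b c r i → a ℕ.+ b ℕ.* (i ℕ.* c ℕ.+ r) ≡ a ℕ.+ b ℕ.* r ℕ.+ b ℕ.* c ℕ.* i
    eq = ℕSolver.solve-∀

  poch-split : ∀ a b {m} → 0 < b → N < m → poch a b m ≈ poch a (b ℕ.* 2) m * poch (a ℕ.+ b) (b ℕ.* 2) m
  poch-split a b {m} 0<b N<m = begin
    poch a b m
      -- With 2m factors in place of m, each of the two residue classes receives exactly m of them.
      ≈⟨ poch-stable a b 0<b N<m (ℕ.<-≤-trans N<m (ℕ.m≤m*n m 2)) ⟩
    poch a b (m ℕ.* 2)
      ≈⟨ poch-residues a b 2 m ⟩
    1# * poch (a ℕ.+ b ℕ.* 0) (b ℕ.* 2) m * poch (a ℕ.+ b ℕ.* 1) (b ℕ.* 2) m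
      ≈⟨ *-congʳ (*-identityˡ _) ⟩
    poch (a ℕ.+ b ℕ.* 0) (b ℕ.* 2) m * poch (a ℕ.+ b ℕ.* 1) (b ℕ.* 2) m
      ≡⟨ ≡.cong₂ (λ d e → poch d (b ℕ.* 2) m * poch e (b ℕ.* 2) m)
           (≡.trans (≡.cong (a ℕ.+_) (ℕ.*-zeroʳ b)) (ℕ.+-identityʳ a)) (≡.cong (a ℕ.+_) (ℕ.*-identityʳ b)) ⟩
    poch a (b ℕ.* 2) m * poch (a ℕ.+ b) (b ℕ.* 2) m ∎

  poch-all-residues : ∀ c .{{_ : ℕ.NonZero c}} {m} → N < m → poch 1 1 m ≈ ∏ (λ r → poch (1 ℕ.+ 1 ℕ.* r) (1 ℕ.* c) m) c
  poch-all-residues c {m} N<m = trans (poch-stable 1 1 (s≤s z≤n) N<m (ℕ.<-≤-trans N<m (ℕ.m≤m*n m c))) (poch-residues 1 1 c m)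

  cancel : ∀ {e i f g} → i * e ≈ 1# → f * e ≈ g * e → f ≈ g
  cancel {e} {i} {f} {g} ie≈1 fe≈ge = begin
    f             ≈⟨ undo f ⟨
    f * e * i     ≈⟨ *-congʳ fe≈ge ⟩
    g * e * i     ≈⟨ undo g ⟩
    g             ∎
    where
    undo : ∀ h → h * e * i ≈ h
    undo h = trans (*-assoc h e i) (trans (*-congˡ (trans (*-comm e i) ie≈1)) (*-identityʳ h))

  open +-*-Solver using (Polynomial; con; _:+_) renaming (⟦_⟧ to ⟦_⟧ᵉ; ⟦_⟧↓ to ⟦_⟧ᵉ↓; prove to proveᵉ)

  -- Products of powers of q whose exponents are syntactic polynomials, so that exponents are compared by normalisation.
  data Monomial (n : ℕ) : Set where
    ε   : Monomial n
    `_  : Polynomial n → Monomial n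
    _·_ : Monomial n → Monomial n → Monomial n

  infixl 7 _·_
  infix  9 `_

  exponent : ∀ {n} → Monomial n → Polynomial n
  exponent ε       = con 0
  exponent (` e)   = e
  exponent (m · n) = exponent m :+ exponent n

  ⟦_⟧ : ∀ {n} → Monomial n → Vec ℕ n → Carrier
  ⟦ ε ⟧     ρ = 1#
  ⟦ ` e ⟧   ρ = X (⟦ e ⟧ᵉ ρ)
  ⟦ m · n ⟧ ρ = ⟦ m ⟧ ρ * ⟦ n ⟧ ρ

  X-exponent : ∀ {n} (m : Monomial n) ρ → X (⟦ exponent m ⟧ᵉ ρ) ≈ ⟦ m ⟧ ρ
  X-exponent ε       ρ = X-0
  X-exponent (` e)   ρ = refl
  X-exponent (m · n) ρ = trans (X-+ (⟦ exponent m ⟧ᵉ ρ) (⟦ exponent n ⟧ᵉ ρ)) (*-cong (X-exponent m ρ) (X-exponent n ρ))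

  monomial : ∀ {n} (ρ : Vec ℕ n) e m → ⟦ e ⟧ᵉ↓ ρ ≡ ⟦ exponent m ⟧ᵉ↓ ρ → X (⟦ e ⟧ᵉ ρ) ≈ ⟦ m ⟧ ρ
  monomial ρ e m eq = trans (reflexive (≡.cong X (proveᵉ ρ e (exponent m) eq))) (X-exponent m ρ)

-- The finite quintuple product identity

-- The number k(k-1)/2, given by a recurrence free of division and subtraction.
triangle : ℕ → ℕ
triangle zero    = 0
triangle (suc k) = triangle k ℕ.+ k

-- Two constructors per step make `P (double (suc m))` unfold to `P (double m)` times two further
-- factors, the shape that the certificate expects.
double : ℕ → ℕ
double zero    = 0
double (suc m) = suc (suc (double m))

double-+ : ∀ m → double m ≡ m ℕ.+ m
double-+ zero    = ≡.refl
double-+ (suc m) = ≡.cong suc (≡.trans (≡.cong suc (double-+ m)) (≡.sym (ℕ.+-suc m m)))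

double-≥ : ∀ n → n ≤ double n
double-≥ zero    = z≤n
double-≥ (suc n) = s≤s (ℕ.m≤n⇒m≤1+n (double-≥ n))

1+[m+n]∸m : ∀ m n → suc (m ℕ.+ n) ∸ m ≡ suc n
1+[m+n]∸m m n = ≡.trans (≡.cong (_∸ m) (≡.sym (ℕ.+-suc m n))) (ℕ.m+n∸m≡n m (suc n))

-- The term of index k of Q_b is T⁺ k = q^τ(k) (1 − q^(1+bk)) for k ≥ 0; the term of index −(k+1) is
-- T⁻ k = q^σ(k) (q^(b(k+1)) − q).  Writing b = 3 + c keeps all exponents free of subtraction.
module Exponents (c : ℕ) where
  b = 3 ℕ.+ c

  τ σ : ℕ → ℕ
  τ k = 3 ℕ.* b ℕ.* triangle k ℕ.+ (b ℕ.+ 3) ℕ.* k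
  σ k = 3 ℕ.* b ℕ.* (triangle k ℕ.+ k) ℕ.+ c ℕ.* k ℕ.+ c

module FiniteQuintuple {R : CommutativeRing 0ℓ 0ℓ} {N : ℕ} (S : TruncatedPowers R N) (c : ℕ) where

  open CommutativeRing R
  open TruncatedPowers S
  open Products S
  open Certificate R
  open Exponents c
  open import Algebra.Properties.Ring ring using (-0#≈0#)
  open SetoidReasoning setoid

  T⁺ T⁻ : ℕ → Carrier
  T⁺ k = X (τ k) * (1# - X (1 ℕ.+ b ℕ.* k))
  T⁻ k = X (σ k) * (X (b ℕ.* suc k) - X 1)

  -- q^b, factored so that q^(b−2) = X 1 * X c is a subterm.
  p : Carrier
  p = X 1 * X 1 * (X 1 * X c)

  P Gp Gm O : ℕ → Carrier
  P  = poch b b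
  Gp n = pochInv b b n * pochInv (2 ℕ.+ b) b n
  Gm n = pochInv b b n * pochInv (1 ℕ.+ c) b n
  O m = (1# + X (1 ℕ.+ b ℕ.+ b ℕ.* m)) * (1# + X (2 ℕ.+ c ℕ.+ b ℕ.* m))

  pochInv-step : ∀ d e n → 0 < d → 0 < e →
    pochInv d b n * pochInv e b n ≈
    pochInv d b (suc n) * pochInv e b (suc n) * ((1# - X (d ℕ.+ b ℕ.* n)) * (1# - X (e ℕ.+ b ℕ.* n)))
  pochInv-step d e n 0<d 0<e = sym (begin
    pochInv d b n * i * (pochInv e b n * j) * (u * v)     ≈⟨ regroup (pochInv d b n) i (pochInv e b n) j u v ⟩
    pochInv d b n * pochInv e b n * ((i * u) * (j * v))   ≈⟨ *-congˡ (*-cong (inv-1-X _ (ℕ.<-≤-trans 0<d (ℕ.m≤m+n d _))) (inv-1-X _ (ℕ.<-≤-trans 0<e (ℕ.m≤m+n e _)))) ⟩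
    pochInv d b n * pochInv e b n * (1# * 1#)             ≈⟨ trans (*-congˡ (*-identityˡ 1#)) (*-identityʳ _) ⟩
    pochInv d b n * pochInv e b n                         ∎)
    where
    i = inv (d ℕ.+ b ℕ.* n)
    j = inv (e ℕ.+ b ℕ.* n)
    u = 1# - X (d ℕ.+ b ℕ.* n)
    v = 1# - X (e ℕ.+ b ℕ.* n)
    open IntegerCoefficients R
    regroup = solve 6 (λ A i B j u v → A :* i :* (B :* j) :* (u :* v) := A :* B :* ((i :* u) :* (j :* v))) refl

  Gp-step : ∀ n → Gp n ≈ Gp (suc n) * ((1# - X (b ℕ.+ b ℕ.* n)) * (1# - X (2 ℕ.+ b ℕ.+ b ℕ.* n)))
  Gp-step n = pochInv-step b (2 ℕ.+ b) n (s≤s z≤n) (s≤s z≤n)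

  Gm-step : ∀ n → Gm n ≈ Gm (suc n) * ((1# - X (b ℕ.+ b ℕ.* n)) * (1# - X (1 ℕ.+ c ℕ.+ b ℕ.* n)))
  Gm-step n = pochInv-step b (1 ℕ.+ c) n (s≤s z≤n) (s≤s z≤n)

  -- With t the summand and V the telescoping function, O_m·t_{m+1}(k) - t_m(k) = V(k) - V(k-1). The
  -- names with ⁻ give the values at -(k+1), so there m + k and m - k exchange roles in `Gp` and
  -- `Gm`.
  term⁺ term⁻ V⁺ V⁻ : ℕ → ℕ → Carrier
  term⁺ m k = T⁺ k * (P (double m) * (Gp (m ℕ.+ k) * Gm (m ∸ k)))
  term⁻ m k = T⁻ k * (P (double m) * (Gp (m ∸ suc k) * Gm (m ℕ.+ suc k)))
  V⁺ m k = X (τ k) * cert⁺ (X 1) p (X (b ℕ.* k)) (X (b ℕ.* (m ∸ k))) * (P (double m) * (Gp (m ℕ.+ suc k) * Gm (m ∸ k)))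
  V⁻ m k = X (σ k) * cert⁻ (X 1) p (X (b ℕ.* k)) (X (b ℕ.* (m ∸ k))) * (P (double m) * (Gp (m ∸ k) * Gm (m ℕ.+ suc k)))

  X-double : ∀ k m → X (b ℕ.+ b ℕ.* (k ℕ.+ double m)) ≈ X (b ℕ.+ b ℕ.* (k ℕ.+ (m ℕ.+ m)))
  X-double k m = reflexive (≡.cong (λ n → X (b ℕ.+ b ℕ.* (k ℕ.+ n))) (double-+ m))

  open +-*-Solver using (Polynomial; con; _:+_; _:*_; var)
  open import Data.Fin using (#_)

  module Symbols {n : ℕ} (cₑ : Polynomial n) where
    bₑ : Polynomial n
    bₑ = con 3 :+ cₑ
    ŷ x̂ r̂ p̂ : Monomial n
    ŷ = ` con 1
    x̂ = ` cₑ
    r̂ = ŷ · x̂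
    p̂ = ŷ · ŷ · r̂

  term⁺-step : ∀ j d → let m = suc (j ℕ.+ d) in
    O m * term⁺ (suc m) (suc j) - term⁺ m (suc j) ≈ V⁺ m (suc j) - V⁺ m j
  term⁺-step j d rewrite ℕ.m+n∸m≡n j d | 1+[m+n]∸m j d | ℕ.+-suc (j ℕ.+ d) (suc j) | ℕ.+-suc (j ℕ.+ d) j = pos-step
    (monomial ρ (bₑ :* (con 1 :+ jₑ)) â′ ≡.refl)
    (monomial ρ (bₑ :* (con 1 :+ dₑ)) (p̂ · L̂) ≡.refl)
    (monomial ρ (con 3 :* bₑ :* (tₑ :+ jₑ) :+ (bₑ :+ con 3) :* (con 1 :+ jₑ)) (τ̂ · (ŷ · ŷ · ŷ · p̂ · â · â · â)) ≡.refl)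
    (monomial ρ (con 1 :+ bₑ :* (con 1 :+ jₑ)) (ŷ · â′) ≡.refl)
    (monomial ρ (con 1 :+ bₑ :+ bₑ :* mₑ) (ŷ · M̂) ≡.refl)
    (monomial ρ (con 2 :+ cₑ :+ bₑ :* mₑ) (ŷ · r̂ · â′ · L̂) ≡.refl)
    (trans (X-double 0 m) (monomial ρ (bₑ :+ bₑ :* (mₑ :+ mₑ)) (p̂ · â′ · â′ · L̂ · L̂) ≡.refl))
    (trans (X-double 1 m) (monomial ρ (bₑ :+ bₑ :* (con 1 :+ (mₑ :+ mₑ))) (M̂ · M̂) ≡.refl))
    (Gp-step n)
    (monomial ρ (bₑ :+ bₑ :* nₑ) (M̂ · â′) ≡.refl)
    (monomial ρ (con 2 :+ bₑ :+ bₑ :* nₑ) (M̂ · â′ · ŷ · ŷ) ≡.refl)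
    (Gm-step d)
    (monomial ρ (bₑ :+ bₑ :* dₑ) (p̂ · L̂) ≡.refl)
    (monomial ρ (con 1 :+ cₑ :+ bₑ :* dₑ) (r̂ · L̂) ≡.refl)
    where
    m = suc (j ℕ.+ d)
    n = suc (suc (j ℕ.+ d ℕ.+ j))
    ρ = c ∷ j ∷ d ∷ triangle j ∷ []
    cₑ = var (# 0)
    jₑ = var (# 1)
    dₑ = var (# 2)
    tₑ = var (# 3)
    open Symbols cₑ
    mₑ = con 1 :+ (jₑ :+ dₑ)
    nₑ = con 2 :+ (jₑ :+ dₑ :+ jₑ)
    â  = ` (bₑ :* jₑ)
    â′ = p̂ · â
    L̂  = ` (bₑ :* dₑ)
    τ̂  = ` (con 3 :* bₑ :* tₑ :+ (bₑ :+ con 3) :* jₑ)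
    M̂  = p̂ · â′ · L̂

  term⁺-end : ∀ m → O m * term⁺ (suc m) (suc m) ≈ - V⁺ m m
  term⁺-end m rewrite ℕ.n∸n≡0 m = pos-end
    (monomial ρ (bₑ :* con 0) ε ≡.refl)
    (monomial ρ (con 3 :* bₑ :* (tₑ :+ mₑ) :+ (bₑ :+ con 3) :* (con 1 :+ mₑ)) (τ̂ · (ŷ · ŷ · ŷ · p̂ · â · â · â)) ≡.refl)
    (monomial ρ (con 1 :+ bₑ :* (con 1 :+ mₑ)) (ŷ · M̂) ≡.refl)
    (monomial ρ (con 1 :+ bₑ :+ bₑ :* mₑ) (ŷ · M̂) ≡.refl)
    (monomial ρ (con 2 :+ cₑ :+ bₑ :* mₑ) (ŷ · r̂ · â) ≡.refl)
    (trans (X-double 0 m) (monomial ρ (bₑ :+ bₑ :* (mₑ :+ mₑ)) (p̂ · â · â) ≡.refl))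
    (trans (X-double 1 m) (monomial ρ (bₑ :+ bₑ :* (con 1 :+ (mₑ :+ mₑ))) (M̂ · M̂) ≡.refl))
    (Gp-step (m ℕ.+ suc m))
    (monomial ρ (bₑ :+ bₑ :* (mₑ :+ (con 1 :+ mₑ))) (M̂ · M̂) ≡.refl)
    (monomial ρ (con 2 :+ bₑ :+ bₑ :* (mₑ :+ (con 1 :+ mₑ))) (M̂ · M̂ · ŷ · ŷ) ≡.refl)
    where
    ρ = c ∷ m ∷ triangle m ∷ []
    cₑ = var (# 0)
    mₑ = var (# 1)
    tₑ = var (# 2)
    open Symbols cₑ
    â  = ` (bₑ :* mₑ)
    τ̂  = ` (con 3 :* bₑ :* tₑ :+ (bₑ :+ con 3) :* mₑ)
    M̂  = p̂ · â

  term⁺-start : ∀ m → O m * term⁺ (suc m) 0 - term⁺ m 0 ≈ V⁺ m 0 - V⁻ m 0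
  term⁺-start m rewrite ℕ.+-identityʳ m | ℕ.+-comm m 1 = pos-start
    (monomial ρ (bₑ :* con 0) ε ≡.refl)
    (monomial ρ (con 3 :* bₑ :* con 0 :+ (bₑ :+ con 3) :* con 0) ε ≡.refl)
    (monomial ρ (con 3 :* bₑ :* con 0 :+ cₑ :* con 0 :+ cₑ) x̂ ≡.refl)
    (monomial ρ (con 1 :+ bₑ :* con 0) ŷ ≡.refl)
    (monomial ρ (con 1 :+ bₑ :+ bₑ :* mₑ) (ŷ · M̂) ≡.refl)
    (monomial ρ (con 2 :+ cₑ :+ bₑ :* mₑ) (ŷ · r̂ · B̂) ≡.refl)
    (trans (X-double 0 m) (monomial ρ (bₑ :+ bₑ :* (mₑ :+ mₑ)) (p̂ · B̂ · B̂) ≡.refl))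
    (trans (X-double 1 m) (monomial ρ (bₑ :+ bₑ :* (con 1 :+ (mₑ :+ mₑ))) (M̂ · M̂) ≡.refl))
    (Gp-step m)
    (monomial ρ (bₑ :+ bₑ :* mₑ) M̂ ≡.refl)
    (monomial ρ (con 2 :+ bₑ :+ bₑ :* mₑ) (M̂ · ŷ · ŷ) ≡.refl)
    (Gm-step m)
    (monomial ρ (bₑ :+ bₑ :* mₑ) M̂ ≡.refl)
    (monomial ρ (con 1 :+ cₑ :+ bₑ :* mₑ) (r̂ · B̂) ≡.refl)
    where
    ρ = c ∷ m ∷ []
    cₑ = var (# 0)
    mₑ = var (# 1)
    open Symbols cₑ
    B̂  = ` (bₑ :* mₑ)
    M̂  = p̂ · B̂

  term⁻-step : ∀ k d → let m = suc (k ℕ.+ d) in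
    O m * term⁻ (suc m) k - term⁻ m k ≈ V⁻ m k - V⁻ m (suc k)
  term⁻-step k d rewrite ℕ.m+n∸m≡n k d | 1+[m+n]∸m k d | ℕ.+-suc (k ℕ.+ d) (suc k) | ℕ.+-suc (k ℕ.+ d) k = neg-step
    (monomial ρ (bₑ :* (con 1 :+ kₑ)) â′ ≡.refl)
    (monomial ρ (bₑ :* (con 1 :+ dₑ)) (p̂ · L̂) ≡.refl)
    (monomial ρ (con 3 :* bₑ :* (tₑ :+ kₑ :+ (con 1 :+ kₑ)) :+ cₑ :* (con 1 :+ kₑ) :+ cₑ) (σ̂ · (x̂ · â′ · â′ · â′)) ≡.refl)
    (monomial ρ (con 1 :+ bₑ :+ bₑ :* mₑ) (ŷ · M̂) ≡.refl)
    (monomial ρ (con 2 :+ cₑ :+ bₑ :* mₑ) (ŷ · r̂ · â′ · L̂) ≡.refl)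
    (trans (X-double 0 m) (monomial ρ (bₑ :+ bₑ :* (mₑ :+ mₑ)) (p̂ · â′ · â′ · L̂ · L̂) ≡.refl))
    (trans (X-double 1 m) (monomial ρ (bₑ :+ bₑ :* (con 1 :+ (mₑ :+ mₑ))) (M̂ · M̂) ≡.refl))
    (Gp-step d)
    (monomial ρ (bₑ :+ bₑ :* dₑ) (p̂ · L̂) ≡.refl)
    (monomial ρ (con 2 :+ bₑ :+ bₑ :* dₑ) (p̂ · L̂ · ŷ · ŷ) ≡.refl)
    (Gm-step n)
    (monomial ρ (bₑ :+ bₑ :* nₑ) (M̂ · â′) ≡.refl)
    (monomial ρ (con 1 :+ cₑ :+ bₑ :* nₑ) (r̂ · â′ · â′ · L̂) ≡.refl)
    where
    m = suc (k ℕ.+ d)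
    n = suc (suc (k ℕ.+ d ℕ.+ k))
    ρ = c ∷ k ∷ d ∷ triangle k ∷ []
    cₑ = var (# 0)
    kₑ = var (# 1)
    dₑ = var (# 2)
    tₑ = var (# 3)
    open Symbols cₑ
    mₑ = con 1 :+ (kₑ :+ dₑ)
    nₑ = con 2 :+ (kₑ :+ dₑ :+ kₑ)
    â  = ` (bₑ :* kₑ)
    â′ = p̂ · â
    L̂  = ` (bₑ :* dₑ)
    σ̂  = ` (con 3 :* bₑ :* (tₑ :+ kₑ) :+ cₑ :* kₑ :+ cₑ)
    M̂  = p̂ · â′ · L̂

  term⁻-end : ∀ m → O m * term⁻ (suc m) m ≈ V⁻ m m
  term⁻-end m rewrite ℕ.n∸n≡0 m = neg-end
    (monomial ρ (bₑ :* (con 1 :+ mₑ)) M̂ ≡.refl)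
    (monomial ρ (bₑ :* con 0) ε ≡.refl)
    (monomial ρ (con 1 :+ bₑ :+ bₑ :* mₑ) (ŷ · M̂) ≡.refl)
    (monomial ρ (con 2 :+ cₑ :+ bₑ :* mₑ) (ŷ · r̂ · â) ≡.refl)
    (trans (X-double 0 m) (monomial ρ (bₑ :+ bₑ :* (mₑ :+ mₑ)) (p̂ · â · â) ≡.refl))
    (trans (X-double 1 m) (monomial ρ (bₑ :+ bₑ :* (con 1 :+ (mₑ :+ mₑ))) (M̂ · M̂) ≡.refl))
    (Gm-step (m ℕ.+ suc m))
    (monomial ρ (bₑ :+ bₑ :* (mₑ :+ (con 1 :+ mₑ))) (M̂ · M̂) ≡.refl)
    (monomial ρ (con 1 :+ cₑ :+ bₑ :* (mₑ :+ (con 1 :+ mₑ))) (r̂ · p̂ · â · â) ≡.refl)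
    where
    ρ = c ∷ m ∷ []
    cₑ = var (# 0)
    mₑ = var (# 1)
    open Symbols cₑ
    â  = ` (bₑ :* mₑ)
    M̂  = p̂ · â

  Z : ℕ → Carrier
  Z m = ∑ (term⁺ m) (suc m) + ∑ (term⁻ m) m

  module _ where
    open IntegerCoefficients R using (solve; _:=_; _:-_) renaming (_:+_ to _⊞_; _:*_ to _⊠_; :-_ to ⊝_; con to conℤ)

    telescope : ∀ {o s s′ t t′ u v w} → o * s′ ≈ s + (u - v) → o * t′ - t ≈ w - u → o * (s′ + t′) ≈ s + t + (w - v)
    telescope {o} {s} {s′} {t} {t′} {u} {v} {w} p₁ p₂ = begin
      o * (s′ + t′)                        ≈⟨ solve 4 (λ o s′ t′ t → o ⊠ (s′ ⊞ t′) := o ⊠ s′ ⊞ (o ⊠ t′ :- t) ⊞ t) refl o s′ t′ t ⟩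
      o * s′ + (o * t′ - t) + t            ≈⟨ +-congʳ (+-cong p₁ p₂) ⟩
      s + (u - v) + (w - u) + t            ≈⟨ solve 5 (λ s u v w t → s ⊞ (u :- v) ⊞ (w :- u) ⊞ t := s ⊞ t ⊞ (w :- v)) refl s u v w t ⟩
      s + t + (w - v)                      ∎

    ∑term⁺ : ∀ m j → j ≤ m → O m * ∑ (term⁺ (suc m)) (suc j) ≈ ∑ (term⁺ m) (suc j) + (V⁺ m j - V⁻ m 0)
    ∑term⁺ m zero    _   = telescope (trans (zeroʳ _) (sym (trans (+-congˡ (-‿inverseʳ (V⁻ m 0))) (+-identityˡ 0#)))) (term⁺-start m)
    ∑term⁺ m (suc j) j<m with ℕ.m≤n⇒∃[o]m+o≡n j<m
    ... | d , ≡.refl = telescope (∑term⁺ m j (ℕ.<⇒≤ j<m)) (term⁺-step j d)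

    -- As k grows, the index -(k+1) decreases; entering `V⁻` negated lets `telescope` serve this
    -- half as well.
    ∑term⁻ : ∀ m k → k ≤ m → O m * ∑ (term⁻ (suc m)) k ≈ ∑ (term⁻ m) k + (- V⁻ m k - - V⁻ m 0)
    ∑term⁻ m zero    _   = trans (zeroʳ _) (sym (trans (+-congˡ (-‿inverseʳ (- V⁻ m 0))) (+-identityˡ 0#)))
    ∑term⁻ m (suc k) k<m with ℕ.m≤n⇒∃[o]m+o≡n k<m
    ... | d , ≡.refl = telescope (∑term⁻ m k (ℕ.<⇒≤ k<m))
      (trans (term⁻-step k d) (solve 2 (λ u v → u :- v := ⊝ v :- ⊝ u) refl _ _))

    Z-step : ∀ m → O m * Z (suc m) ≈ Z m
    Z-step m = begin
      O m * (∑ (term⁺ (suc m)) (suc m) + term⁺ (suc m) (suc m) + (∑ (term⁻ (suc m)) m + term⁻ (suc m) m))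
        ≈⟨ solve 5 (λ o s t s′ t′ → o ⊠ (s ⊞ t ⊞ (s′ ⊞ t′)) := o ⊠ s ⊞ o ⊠ t ⊞ (o ⊠ s′ ⊞ o ⊠ t′)) refl _ _ _ _ _ ⟩
      O m * ∑ (term⁺ (suc m)) (suc m) + O m * term⁺ (suc m) (suc m) + (O m * ∑ (term⁻ (suc m)) m + O m * term⁻ (suc m) m)
        ≈⟨ +-cong (+-cong (∑term⁺ m m ℕ.≤-refl) (term⁺-end m)) (+-cong (∑term⁻ m m ℕ.≤-refl) (term⁻-end m)) ⟩
      ∑ (term⁺ m) (suc m) + (V⁺ m m - V⁻ m 0) + - V⁺ m m + (∑ (term⁻ m) m + (- V⁻ m m - - V⁻ m 0) + V⁻ m m)
        -- V at -1 cancels between the two halves, and V at m and at -(m+1) cancels against the two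
        -- new end terms.
        ≈⟨ solve 5 (λ s s′ u v w → s ⊞ (u :- v) ⊞ ⊝ u ⊞ (s′ ⊞ (⊝ w :- ⊝ v) ⊞ w) := s ⊞ s′) refl _ _ _ _ _ ⟩
      Z m ∎

    Z-zero : Z 0 ≈ 1# - X 1
    Z-zero = begin
      0# + X (τ 0) * (1# - X (1 ℕ.+ b ℕ.* 0)) * (1# * (1# * 1# * (1# * 1#))) + 0#
        ≈⟨ +-congʳ (+-congˡ (*-congʳ (*-cong (monomial ρ (con 3 :* bₑ :* con 0 :+ (bₑ :+ con 3) :* con 0) ε ≡.refl)
             (1-cong (monomial ρ (con 1 :+ bₑ :* con 0) ŷ ≡.refl))))) ⟩
      0# + 1# * (1# - X 1) * (1# * (1# * 1# * (1# * 1#))) + 0#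
        ≈⟨ solve 1 (λ y → conℤ (+ 0) ⊞ 𝟙 ⊠ (𝟙 :- y) ⊠ (𝟙 ⊠ (𝟙 ⊠ 𝟙 ⊠ (𝟙 ⊠ 𝟙))) ⊞ conℤ (+ 0) := 𝟙 :- y) refl (X 1) ⟩
      1# - X 1 ∎
      where
      ρ = c ∷ []
      open Symbols (var (# 0))
      open Poly using (𝟙)

    ∏O-Z : ∀ m → ∏ O m * Z m ≈ 1# - X 1
    ∏O-Z zero    = trans (*-identityˡ (Z 0)) Z-zero
    ∏O-Z (suc m) = trans (*-assoc _ _ _) (trans (*-congˡ (Z-step m)) (∏O-Z m))

-- The quintuple product identity

module QuintupleProduct {R : CommutativeRing 0ℓ 0ℓ} {N : ℕ} (S : TruncatedPowers R N) (c : ℕ) where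

  open CommutativeRing R
  open TruncatedPowers S
  open Products S
  open Certificate R using (1-cong)
  open Exponents c
  open FiniteQuintuple S c
  open IntegerCoefficients R
  open SetoidReasoning setoid

  Θ : ℕ → Carrier
  Θ K = ∑ T⁺ K + ∑ T⁻ K

  T⁺-high : ∀ k → N < k → T⁺ k ≈ 0#
  T⁺-high k N<k = trans (*-congʳ (X-high (exponent-high (3 ℕ.* b ℕ.* triangle k) (b ℕ.+ 3) k (s≤s z≤n) N<k))) (zeroˡ _)

  T⁻-high : ∀ k → N < k → T⁻ k ≈ 0#
  T⁻-high k N<k = trans (*-congʳ (X-high (ℕ.<-≤-trans N<k k≤σ))) (zeroˡ _)
    where
    k≤σ : k ≤ σ k
    k≤σ = ℕ.≤-trans (ℕ.m≤n+m k (triangle k)) (ℕ.≤-trans (ℕ.m≤n*m (triangle k ℕ.+ k) (3 ℕ.* b))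
      (ℕ.≤-trans (ℕ.m≤m+n _ (c ℕ.* k)) (ℕ.m≤m+n _ c)))

  Θ-stable : ∀ {m n m′ n′} → N < m → N < n → N < m′ → N < n′ → ∑ T⁺ m + ∑ T⁻ n ≈ ∑ T⁺ m′ + ∑ T⁻ n′
  Θ-stable N<m N<n N<m′ N<n′ = +-cong
    (∑-stable T⁺ (λ i m≤i → T⁺-high i (ℕ.<-≤-trans N<m m≤i)) (λ i m≤i → T⁺-high i (ℕ.<-≤-trans N<m′ m≤i)))
    (∑-stable T⁻ (λ i m≤i → T⁻-high i (ℕ.<-≤-trans N<n m≤i)) (λ i m≤i → T⁻-high i (ℕ.<-≤-trans N<n′ m≤i)))

  Gp-stable : ∀ {m n} → N < m → N < n → Gp m ≈ Gp n
  Gp-stable N<m N<n = *-cong (pochInv-stable b b (s≤s z≤n) N<m N<n) (pochInv-stable (2 ℕ.+ b) b (s≤s z≤n) N<m N<n)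

  Gm-stable : ∀ {m n} → N < m → N < n → Gm m ≈ Gm n
  Gm-stable N<m N<n = *-cong (pochInv-stable b b (s≤s z≤n) N<m N<n) (pochInv-stable (1 ℕ.+ c) b (s≤s z≤n) N<m N<n)

  private
    -- With m = 2(N+1), m - k still exceeds N for all k ≤ N + 1, so both m + k and m - k are in the
    -- stable range wherever the power of q in front survives.
    m : ℕ
    m = suc N ℕ.+ suc N

    N<m : N < m
    N<m = ℕ.m≤m+n (suc N) (suc N)

    N<m∸ : ∀ {k} → k ≤ suc N → N < m ∸ k
    N<m∸ {k} k≤1+N = ℕ.m+n≤o⇒m≤o∸n (suc N) (ℕ.+-monoʳ-≤ (suc N) k≤1+N)

  weight : Carrier
  weight = P (double m) * (Gp m * Gm m)

  -- For k ≤ N the factors Gp and Gm have reached their limits; for k > N the power of q in front vanishes.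
  term⁺-limit : ∀ k → term⁺ m k ≈ T⁺ k * weight
  term⁺-limit k with k ℕ.≤? N
  ... | yes k≤N = *-congˡ (*-congˡ (*-cong (Gp-stable (ℕ.<-≤-trans N<m (ℕ.m≤m+n m k)) N<m) (Gm-stable (N<m∸ (ℕ.m≤n⇒m≤1+n k≤N)) N<m)))
  ... | no  k≰N = trans (trans (*-congʳ high) (zeroˡ _)) (sym (trans (*-congʳ high) (zeroˡ _)))
    where high = T⁺-high k (ℕ.≰⇒> k≰N)

  term⁻-limit : ∀ k → term⁻ m k ≈ T⁻ k * weight
  term⁻-limit k with k ℕ.≤? N
  ... | yes k≤N = *-congˡ (*-congˡ (*-cong (Gp-stable (N<m∸ (s≤s k≤N)) N<m) (Gm-stable (ℕ.<-≤-trans N<m (ℕ.m≤m+n m (suc k))) N<m)))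
  ... | no  k≰N = trans (trans (*-congʳ high) (zeroˡ _)) (sym (trans (*-congʳ high) (zeroˡ _)))
    where high = T⁻-high k (ℕ.≰⇒> k≰N)

  Z-limit : Z m ≈ Θ m * weight
  Z-limit = begin
    ∑ (term⁺ m) (suc m) + ∑ (term⁻ m) m
      ≈⟨ +-cong (∑-cong (suc m) (λ k _ → term⁺-limit k)) (∑-cong m (λ k _ → term⁻-limit k)) ⟩
    ∑ (λ k → T⁺ k * weight) (suc m) + ∑ (λ k → T⁻ k * weight) m
      ≈⟨ +-cong (∑-*ʳ T⁺ (suc m) weight) (∑-*ʳ T⁻ m weight) ⟨
    ∑ T⁺ (suc m) * weight + ∑ T⁻ m * weight
      ≈⟨ distribʳ weight _ _ ⟨
    (∑ T⁺ (suc m) + ∑ T⁻ m) * weight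
      ≈⟨ *-congʳ (Θ-stable (ℕ.m<n⇒m<1+n N<m) N<m N<m N<m) ⟩
    Θ m * weight ∎

  private
    Q₁ Q₂ Q₃ Q₂′ Q₃′ H₁ H₂ E₁ E₂ : Carrier
    Q₁  = poch b b m
    Q₂  = poch (2 ℕ.+ b) b m
    Q₃  = poch (1 ℕ.+ c) b m
    Q₂′ = poch (2 ℕ.+ b) (b ℕ.* 2) m
    Q₃′ = poch (1 ℕ.+ c) (b ℕ.* 2) m
    H₁  = poch (1 ℕ.+ b) b m
    H₂  = poch (2 ℕ.+ c) b m
    E₁  = poch (2 ℕ.+ b ℕ.+ b) (b ℕ.* 2) m
    E₂  = poch (1 ℕ.+ c ℕ.+ b) (b ℕ.* 2) m

  weight-inverse : weight * (Q₁ * Q₂ * Q₃) ≈ 1#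
  weight-inverse = begin
    P (double m) * (Gp m * Gm m) * (Q₁ * Q₂ * Q₃)
      ≈⟨ *-congʳ (*-congʳ (poch-stable b b (s≤s z≤n) (ℕ.<-≤-trans N<m (double-≥ m)) N<m)) ⟩
    Q₁ * (Gp m * Gm m) * (Q₁ * Q₂ * Q₃)
      ≈⟨ solve 6 (λ q₁ q₂ q₃ i₁ i₂ i₃ → q₁ :* (i₁ :* i₂ :* (i₁ :* i₃)) :* (q₁ :* q₂ :* q₃)
           := (i₁ :* q₁) :* (i₁ :* q₁) :* (i₂ :* q₂) :* (i₃ :* q₃)) refl _ _ _ _ _ _ ⟩
    _ ≈⟨ *-cong (*-cong (*-cong (pochInv-poch b b m (s≤s z≤n)) (pochInv-poch b b m (s≤s z≤n)))
           (pochInv-poch (2 ℕ.+ b) b m (s≤s z≤n))) (pochInv-poch (1 ℕ.+ c) b m (s≤s z≤n)) ⟩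
    1# * 1# * 1# * 1#
      ≈⟨ trans (*-identityʳ _) (trans (*-identityʳ _) (*-identityʳ _)) ⟩
    1# ∎

  ∏O-Θ : ∏ O m * Θ m ≈ (1# - X 1) * (Q₁ * Q₂ * Q₃)
  ∏O-Θ = begin
    ∏ O m * Θ m                                 ≈⟨ *-identityʳ _ ⟨
    ∏ O m * Θ m * 1#                            ≈⟨ *-congˡ weight-inverse ⟨
    ∏ O m * Θ m * (weight * (Q₁ * Q₂ * Q₃))     ≈⟨ solve 4 (λ o t w q → o :* t :* (w :* q) := o :* (t :* w) :* q) refl _ _ _ _ ⟩
    ∏ O m * (Θ m * weight) * (Q₁ * Q₂ * Q₃)     ≈⟨ *-congʳ (trans (*-congˡ (sym Z-limit)) (∏O-Z m)) ⟩
    (1# - X 1) * (Q₁ * Q₂ * Q₃)                 ∎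

  difference-of-squares : ∀ d e → d ℕ.+ d ≡ e → (1# + X d) * (1# - X d) ≈ 1# - X e
  difference-of-squares d e ≡.refl = begin
    (1# + X d) * (1# - X d)   ≈⟨ solve 1 (λ z → (con (ℤ.+ 1) :+ z) :* (con (ℤ.+ 1) :- z) := con (ℤ.+ 1) :- z :* z) refl (X d) ⟩
    1# - X d * X d            ≈⟨ 1-cong (X-+ d d) ⟨
    1# - X (d ℕ.+ d)          ∎

  -- Since (1 + x)(1 - x) = 1 - x², multiplying the factors 1 + x of `O` by the factors 1 - x in
  -- `H₁` and `H₂` leaves the 1 - x² in `E₁` and `E₂`, with base q^(2b).
  ∏O-H : ∏ O m * (H₁ * H₂) ≈ E₁ * E₂
  ∏O-H = begin
    ∏ O m * (H₁ * H₂)                   ≈⟨ *-congʳ (∏-* _ _ m) ⟩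
    _                                   ≈⟨ solve 4 (λ o o′ h h′ → o :* o′ :* (h :* h′) := (o :* h) :* (o′ :* h′)) refl _ _ _ _ ⟩
    _                                   ≈⟨ *-cong (∏-* _ _ m) (∏-* _ _ m) ⟨
    _                                   ≈⟨ *-cong
      (∏-cong m (λ i → difference-of-squares (1 ℕ.+ b ℕ.+ b ℕ.* i) _ (eq₁ c i)))
      (∏-cong m (λ i → difference-of-squares (2 ℕ.+ c ℕ.+ b ℕ.* i) _ (eq₂ c i))) ⟩
    E₁ * E₂                             ∎
    where
    eq₁ : ∀ c i → (1 ℕ.+ (3 ℕ.+ c) ℕ.+ (3 ℕ.+ c) ℕ.* i) ℕ.+ (1 ℕ.+ (3 ℕ.+ c) ℕ.+ (3 ℕ.+ c) ℕ.* i)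
                ≡ 2 ℕ.+ (3 ℕ.+ c) ℕ.+ (3 ℕ.+ c) ℕ.+ (3 ℕ.+ c) ℕ.* 2 ℕ.* i
    eq₁ = ℕSolver.solve-∀
    eq₂ : ∀ c i → (2 ℕ.+ c ℕ.+ (3 ℕ.+ c) ℕ.* i) ℕ.+ (2 ℕ.+ c ℕ.+ (3 ℕ.+ c) ℕ.* i)
                ≡ 1 ℕ.+ c ℕ.+ (3 ℕ.+ c) ℕ.+ (3 ℕ.+ c) ℕ.* 2 ℕ.* i
    eq₂ = ℕSolver.solve-∀

  poch-first : (1# - X 1) * H₁ ≈ poch 1 b m
  poch-first = begin
    (1# - X 1) * H₁                               ≈⟨ *-cong (trans (1-cong (reflexive (≡.cong X (≡.cong suc (≡.sym (ℕ.*-zeroʳ b)))))) (sym (*-identityˡ _)))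
                                                       (∏-cong m (λ i → 1-cong (reflexive (≡.cong X (eq c i))))) ⟩
    ∏ F 1 * ∏ (λ i → F (1 ℕ.+ i)) m               ≈⟨ ∏-append F 1 m ⟨
    poch 1 b (suc m)                              ≈⟨ poch-stable 1 b (s≤s z≤n) (ℕ.m<n⇒m<1+n N<m) N<m ⟩
    poch 1 b m                                    ∎
    where
    F : ℕ → Carrier
    F i = 1# - X (1 ℕ.+ b ℕ.* i)
    eq : ∀ c i → 1 ℕ.+ (3 ℕ.+ c) ℕ.+ (3 ℕ.+ c) ℕ.* i ≡ 1 ℕ.+ (3 ℕ.+ c) ℕ.* (1 ℕ.+ i)
    eq = ℕSolver.solve-∀

  product : ℕ → Carrier
  product K = poch 1 b K * poch (2 ℕ.+ c) b K * poch b b K * poch (1 ℕ.+ c) (b ℕ.* 2) K * poch (2 ℕ.+ b) (b ℕ.* 2) K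

  -- `E₁` and `E₂` consist of every second factor of `Q₂` and `Q₃`, as `poch-split` separates them.
  -- Cancelling both leaves `Q₂′` and `Q₃′`, the two products with base q^(2b).
  quintuple-m : Θ m ≈ product m
  quintuple-m = cancel (pochInv-poch (2 ℕ.+ b ℕ.+ b) (b ℕ.* 2) m (s≤s z≤n)) (cancel (pochInv-poch (1 ℕ.+ c ℕ.+ b) (b ℕ.* 2) m (s≤s z≤n)) (begin
    Θ m * E₁ * E₂                                                       ≈⟨ trans (*-assoc _ _ _) (*-congˡ (sym ∏O-H)) ⟩
    Θ m * (∏ O m * (H₁ * H₂))                                           ≈⟨ solve 4 (λ t o h h′ → t :* (o :* (h :* h′)) := o :* t :* (h :* h′)) refl _ _ _ _ ⟩
    ∏ O m * Θ m * (H₁ * H₂)                                             ≈⟨ *-congʳ (trans ∏O-Θ (*-congˡ (*-cong (*-congˡ (poch-split (2 ℕ.+ b) b (s≤s z≤n) N<m)) (poch-split (1 ℕ.+ c) b (s≤s z≤n) N<m)))) ⟩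
    (1# - X 1) * (Q₁ * (Q₂′ * E₁) * (Q₃′ * E₂)) * (H₁ * H₂)             ≈⟨ solve 8 (λ u q₁ q₂ q₃ e₁ e₂ h₁ h₂ →
                                                                             u :* (q₁ :* (q₂ :* e₁) :* (q₃ :* e₂)) :* (h₁ :* h₂)
                                                                             := u :* h₁ :* h₂ :* q₁ :* q₃ :* q₂ :* e₁ :* e₂) refl _ _ _ _ _ _ _ _ ⟩
    (1# - X 1) * H₁ * H₂ * Q₁ * Q₃′ * Q₂′ * E₁ * E₂                     ≈⟨ *-congʳ (*-congʳ (*-congʳ (*-congʳ (*-congʳ (*-congʳ poch-first))))) ⟩
    product m * E₁ * E₂                                                 ∎))

  quintuple : ∀ {K} → N < K → Θ K ≈ product K
  quintuple {K} N<K = begin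
    Θ K         ≈⟨ Θ-stable N<K N<K N<m N<m ⟩
    Θ m         ≈⟨ quintuple-m ⟩
    product m   ≈⟨ *-cong (*-cong (*-cong (*-cong (stable 1 b (s≤s z≤n)) (stable (2 ℕ.+ c) b (s≤s z≤n))) (stable b b (s≤s z≤n)))
                     (stable (1 ℕ.+ c) (b ℕ.* 2) (s≤s z≤n))) (stable (2 ℕ.+ b) (b ℕ.* 2) (s≤s z≤n)) ⟩
    product K   ∎
    where
    stable : ∀ d e → 0 < e → poch d e m ≈ poch d e K
    stable d e 0<e = poch-stable d e 0<e N<m N<K

-- Factors of (q;q)_∞ by residue classes modulo 8 and 10

module ProductIdentities {R : CommutativeRing 0ℓ 0ℓ} {N : ℕ} (S : TruncatedPowers R N) where

  open CommutativeRing R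
  open Products S
  open QuintupleProduct S using (product)
  open IntegerCoefficients R
  open SetoidReasoning setoid

  product₄ : ∀ {K} → N < K → product 1 K ≈ poch 1 1 K
  product₄ {K} N<K = begin
    poch 1 4 K * poch 3 4 K * poch 4 4 K * poch 2 8 K * poch 6 8 K
      ≈⟨ *-congʳ (*-congʳ (*-cong (*-cong (split 1) (split 3)) (split 4))) ⟩
    poch 1 8 K * poch 5 8 K * (poch 3 8 K * poch 7 8 K) * (poch 4 8 K * poch 8 8 K) * poch 2 8 K * poch 6 8 K
      ≈⟨ solve 8 (λ p₁ p₂ p₃ p₄ p₅ p₆ p₇ p₈ →
           p₁ :* p₅ :* (p₃ :* p₇) :* (p₄ :* p₈) :* p₂ :* p₆ := con (+ 1) :* p₁ :* p₂ :* p₃ :* p₄ :* p₅ :* p₆ :* p₇ :* p₈)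
           refl _ _ _ _ _ _ _ _ ⟩
    1# * poch 1 8 K * poch 2 8 K * poch 3 8 K * poch 4 8 K * poch 5 8 K * poch 6 8 K * poch 7 8 K * poch 8 8 K
      ≈⟨ poch-all-residues 8 N<K ⟨
    poch 1 1 K ∎
    where
    split : ∀ a → poch a 4 K ≈ poch a 8 K * poch (a ℕ.+ 4) 8 K
    split a = poch-split a 4 (s≤s z≤n) N<K

  -- Q_5 contains every residue class modulo 10 except 2 and 8, which the two extra products supply.
  product₅ : ∀ {K} → N < K → product 2 K * poch 2 10 K * poch 8 10 K ≈ poch 1 1 K
  product₅ {K} N<K = begin
    poch 1 5 K * poch 4 5 K * poch 5 5 K * poch 3 10 K * poch 7 10 K * poch 2 10 K * poch 8 10 K
      ≈⟨ *-congʳ (*-congʳ (*-congʳ (*-congʳ (*-cong (*-cong (split 1) (split 4)) (split 5))))) ⟩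
    poch 1 10 K * poch 6 10 K * (poch 4 10 K * poch 9 10 K) * (poch 5 10 K * poch 10 10 K) * poch 3 10 K * poch 7 10 K * poch 2 10 K * poch 8 10 K
      ≈⟨ solve 10 (λ p₁ p₂ p₃ p₄ p₅ p₆ p₇ p₈ p₉ p₀ →
           p₁ :* p₆ :* (p₄ :* p₉) :* (p₅ :* p₀) :* p₃ :* p₇ :* p₂ :* p₈
           := con (+ 1) :* p₁ :* p₂ :* p₃ :* p₄ :* p₅ :* p₆ :* p₇ :* p₈ :* p₉ :* p₀)
           refl _ _ _ _ _ _ _ _ _ _ ⟩
    1# * poch 1 10 K * poch 2 10 K * poch 3 10 K * poch 4 10 K * poch 5 10 K * poch 6 10 K * poch 7 10 K * poch 8 10 K * poch 9 10 K * poch 10 10 K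
      ≈⟨ poch-all-residues 10 N<K ⟨
    poch 1 1 K ∎
    where
    split : ∀ a → poch a 5 K ≈ poch a 10 K * poch (a ℕ.+ 5) 10 K
    split a = poch-split a 5 (s≤s z≤n) N<K

-- Formal power series modulo q^(N+1)

sumLt-cong : ∀ n {f g : ℕ → ℤ} → (∀ i → i < n → f i ≡ g i) → sumLt n f ≡ sumLt n g
sumLt-cong zero    eq = ≡.refl
sumLt-cong (suc n) eq = ≡.cong₂ ℤ._+_ (sumLt-cong n (λ i i<n → eq i (ℕ.m<n⇒m<1+n i<n))) (eq n ℕ.≤-refl)

sumLt-+ : ∀ n (f g : ℕ → ℤ) → sumLt n (λ i → f i ℤ.+ g i) ≡ sumLt n f ℤ.+ sumLt n g
sumLt-+ zero    f g = ≡.refl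
sumLt-+ (suc n) f g = ≡.trans (≡.cong (ℤ._+ (f n ℤ.+ g n)) (sumLt-+ n f g)) (interchange (sumLt n f) (sumLt n g) (f n) (g n))
  where
  interchange : ∀ a b c d → (a ℤ.+ b) ℤ.+ (c ℤ.+ d) ≡ (a ℤ.+ c) ℤ.+ (b ℤ.+ d)
  interchange = ℤSolver.solve-∀

sumLt-*ˡ : ∀ n c (f : ℕ → ℤ) → sumLt n (λ i → c ℤ.* f i) ≡ c ℤ.* sumLt n f
sumLt-*ˡ zero    c f = ≡.sym (ℤ.*-zeroʳ c)
sumLt-*ˡ (suc n) c f = ≡.trans (≡.cong (ℤ._+ (c ℤ.* f n)) (sumLt-*ˡ n c f)) (≡.sym (ℤ.*-distribˡ-+ c (sumLt n f) (f n)))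

sumLt-front : ∀ n (f : ℕ → ℤ) → sumLt (suc n) f ≡ f 0 ℤ.+ sumLt n (f ∘ suc)
sumLt-front zero    f = ℤ.+-comm (+ 0) (f 0)
sumLt-front (suc n) f = ≡.trans (≡.cong (ℤ._+ f (suc n)) (sumLt-front n f)) (ℤ.+-assoc (f 0) (sumLt n (f ∘ suc)) (f (suc n)))

sumLt-zero : ∀ n {f : ℕ → ℤ} → (∀ i → i < n → f i ≡ + 0) → sumLt n f ≡ + 0
sumLt-zero zero    eq = ≡.refl
sumLt-zero (suc n) eq = ≡.cong₂ ℤ._+_ (sumLt-zero n (λ i i<n → eq i (ℕ.m<n⇒m<1+n i<n))) (eq n ℕ.≤-refl)

δ-refl : ∀ n → δ n n ≡ + 1
δ-refl n with n ℕ.≟ n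
... | yes _   = ≡.refl
... | no n≢n  = contradiction ≡.refl n≢n

δ-≢ : ∀ {m n} → m ≢ n → δ m n ≡ + 0
δ-≢ {m} {n} m≢n with m ℕ.≟ n
... | yes m≡n = contradiction m≡n m≢n
... | no _    = ≡.refl

δ-suc : ∀ m n → δ (suc m) (suc n) ≡ δ m n
δ-suc m n with m ℕ.≟ n
... | yes ≡.refl = δ-refl (suc m)
... | no m≢n   = δ-≢ (m≢n ∘ ℕ.suc-injective)

tl : Series → Series
tl f n = f (suc n)

infixl 6 _⊕_
infix  8 ⊖_
infixl 7 _•_

_⊕_ : Series → Series → Series
(f ⊕ g) n = f n ℤ.+ g n

⊖_ : Series → Series
(⊖ f) n = ℤ.- f n

_•_ : ℤ → Series → Series
(c • f) n = c ℤ.* f n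

zeroS : Series
zeroS _ = + 0

⊛-head : ∀ f g → (f ⊛ g) 0 ≡ f 0 ℤ.* g 0
⊛-head f g = ℤ.+-identityˡ _

-- This is f = f 0 + q·`tl f` multiplied by g. With it and its mirror image, commutativity and
-- associativity follow by induction on the coefficient, without reindexing a double sum.
⊛-tlˡ : ∀ f g n → (f ⊛ g) (suc n) ≡ f 0 ℤ.* g (suc n) ℤ.+ (tl f ⊛ g) n
⊛-tlˡ f g n = sumLt-front (suc n) (λ i → f i ℤ.* g (suc n ∸ i))

⊛-tlʳ : ∀ f g n → (f ⊛ g) (suc n) ≡ (f ⊛ tl g) n ℤ.+ f (suc n) ℤ.* g 0
⊛-tlʳ f g n = ≡.cong₂ ℤ._+_
  (sumLt-cong (suc n) (λ i i<1+n → ≡.cong (λ j → f i ℤ.* g j) (ℕ.+-∸-assoc 1 (ℕ.s≤s⁻¹ i<1+n))))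
  (≡.cong (λ j → f (suc n) ℤ.* g j) (ℕ.n∸n≡0 n))

⊛-comm : ∀ f g n → (f ⊛ g) n ≡ (g ⊛ f) n
⊛-comm f g zero    = ≡.trans (⊛-head f g) (≡.trans (ℤ.*-comm (f 0) (g 0)) (≡.sym (⊛-head g f)))
⊛-comm f g (suc n) = begin
  (f ⊛ g) (suc n)                          ≡⟨ ⊛-tlˡ f g n ⟩
  f 0 ℤ.* g (suc n) ℤ.+ (tl f ⊛ g) n       ≡⟨ ≡.cong₂ ℤ._+_ (ℤ.*-comm (f 0) (g (suc n))) (⊛-comm (tl f) g n) ⟩
  g (suc n) ℤ.* f 0 ℤ.+ (g ⊛ tl f) n       ≡⟨ ℤ.+-comm (g (suc n) ℤ.* f 0) _ ⟩
  (g ⊛ tl f) n ℤ.+ g (suc n) ℤ.* f 0       ≡⟨ ⊛-tlʳ g f n ⟨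
  (g ⊛ f) (suc n)                          ∎
  where open ≡.≡-Reasoning

⊛-distribʳ : ∀ h f g n → ((f ⊕ g) ⊛ h) n ≡ (f ⊛ h ⊕ g ⊛ h) n
⊛-distribʳ h f g n = ≡.trans
  (sumLt-cong (suc n) (λ i _ → ℤ.*-distribʳ-+ (h (n ∸ i)) (f i) (g i)))
  (sumLt-+ (suc n) (λ i → f i ℤ.* h (n ∸ i)) (λ i → g i ℤ.* h (n ∸ i)))

•-⊛ : ∀ c f g n → ((c • f) ⊛ g) n ≡ (c • (f ⊛ g)) n
•-⊛ c f g n = ≡.trans
  (sumLt-cong (suc n) (λ i _ → ℤ.*-assoc c (f i) (g (n ∸ i))))
  (sumLt-*ˡ (suc n) c (λ i → f i ℤ.* g (n ∸ i)))

⊛-congˡ : ∀ {f f′} g n → (∀ i → i ≤ n → f i ≡ f′ i) → (f ⊛ g) n ≡ (f′ ⊛ g) n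
⊛-congˡ g n eq = sumLt-cong (suc n) (λ i i<1+n → ≡.cong (ℤ._* g (n ∸ i)) (eq i (ℕ.s≤s⁻¹ i<1+n)))

⊛-assoc : ∀ f g h n → ((f ⊛ g) ⊛ h) n ≡ (f ⊛ (g ⊛ h)) n
⊛-assoc f g h zero = begin
  ((f ⊛ g) ⊛ h) 0            ≡⟨ ⊛-head (f ⊛ g) h ⟩
  (f ⊛ g) 0 ℤ.* h 0          ≡⟨ ≡.cong (ℤ._* h 0) (⊛-head f g) ⟩
  f 0 ℤ.* g 0 ℤ.* h 0        ≡⟨ ℤ.*-assoc (f 0) (g 0) (h 0) ⟩
  f 0 ℤ.* (g 0 ℤ.* h 0)      ≡⟨ ≡.cong (f 0 ℤ.*_) (⊛-head g h) ⟨
  f 0 ℤ.* (g ⊛ h) 0          ≡⟨ ⊛-head f (g ⊛ h) ⟨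
  (f ⊛ (g ⊛ h)) 0            ∎
  where open ≡.≡-Reasoning
⊛-assoc f g h (suc n) = begin
  ((f ⊛ g) ⊛ h) (suc n)
    ≡⟨ ⊛-tlˡ (f ⊛ g) h n ⟩
  (f ⊛ g) 0 ℤ.* h (suc n) ℤ.+ (tl (f ⊛ g) ⊛ h) n
    ≡⟨ ≡.cong₂ ℤ._+_ (≡.cong (ℤ._* h (suc n)) (⊛-head f g)) (⊛-congˡ h n (λ i _ → ⊛-tlˡ f g i)) ⟩
  f 0 ℤ.* g 0 ℤ.* h (suc n) ℤ.+ ((f 0 • tl g ⊕ tl f ⊛ g) ⊛ h) n
    ≡⟨ ≡.cong (λ x → f 0 ℤ.* g 0 ℤ.* h (suc n) ℤ.+ x) (⊛-distribʳ h (f 0 • tl g) (tl f ⊛ g) n) ⟩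
  f 0 ℤ.* g 0 ℤ.* h (suc n) ℤ.+ (((f 0 • tl g) ⊛ h) n ℤ.+ ((tl f ⊛ g) ⊛ h) n)
    ≡⟨ ≡.cong₂ (λ x y → f 0 ℤ.* g 0 ℤ.* h (suc n) ℤ.+ (x ℤ.+ y)) (•-⊛ (f 0) (tl g) h n) (⊛-assoc (tl f) g h n) ⟩
  f 0 ℤ.* g 0 ℤ.* h (suc n) ℤ.+ (f 0 ℤ.* (tl g ⊛ h) n ℤ.+ (tl f ⊛ (g ⊛ h)) n)
    ≡⟨ regroup (f 0) (g 0) (h (suc n)) ((tl g ⊛ h) n) ((tl f ⊛ (g ⊛ h)) n) ⟩
  f 0 ℤ.* (g 0 ℤ.* h (suc n) ℤ.+ (tl g ⊛ h) n) ℤ.+ (tl f ⊛ (g ⊛ h)) n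
    ≡⟨ ≡.cong (λ x → f 0 ℤ.* x ℤ.+ (tl f ⊛ (g ⊛ h)) n) (⊛-tlˡ g h n) ⟨
  f 0 ℤ.* (g ⊛ h) (suc n) ℤ.+ (tl f ⊛ (g ⊛ h)) n
    ≡⟨ ⊛-tlˡ f (g ⊛ h) n ⟨
  (f ⊛ (g ⊛ h)) (suc n) ∎
  where
  open ≡.≡-Reasoning
  regroup : ∀ a b c x y → a ℤ.* b ℤ.* c ℤ.+ (a ℤ.* x ℤ.+ y) ≡ a ℤ.* (b ℤ.* c ℤ.+ x) ℤ.+ y
  regroup = ℤSolver.solve-∀

⊛-identityˡ : ∀ f n → (oneS ⊛ f) n ≡ f n
⊛-identityˡ f zero    = ≡.trans (⊛-head oneS f) (ℤ.*-identityˡ (f 0))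
⊛-identityˡ f (suc n) = ≡.trans (⊛-tlˡ oneS f n) (≡.trans
  (≡.cong₂ ℤ._+_ (ℤ.*-identityˡ (f (suc n)))
    (sumLt-zero (suc n) (λ i _ → ≡.trans (≡.cong (ℤ._* f (n ∸ i)) (δ-≢ {suc i} {0} λ ())) (ℤ.*-zeroˡ (f (n ∸ i))))))
  (ℤ.+-identityʳ (f (suc n))))

infix 4 _≈[_]_

-- Congruence modulo q^(N+1). As a record type it is injective in its arguments, so N and both
-- series can be recovered by unification, which a bare function type would not allow.
record _≈[_]_ (f : Series) (N : ℕ) (g : Series) : Set where
  constructor coeffs
  field coeff : ∀ n → n ≤ N → f n ≡ g n

open _≈[_]_ public

exact : ∀ {N f g} → (∀ n → f n ≡ g n) → f ≈[ N ] g
exact eq = coeffs λ n _ → eq n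

⊛-cong : ∀ {N f f′ g g′} → f ≈[ N ] f′ → g ≈[ N ] g′ → f ⊛ g ≈[ N ] f′ ⊛ g′
⊛-cong {f′ = f′} {g} {g′} p q = coeffs λ n n≤N → ≡.trans
  (⊛-congˡ g n (λ i i≤n → coeff p i (ℕ.≤-trans i≤n n≤N)))
  (sumLt-cong (suc n) (λ i _ → ≡.cong (f′ i ℤ.*_) (coeff q (n ∸ i) (ℕ.≤-trans (ℕ.m∸n≤m n i) n≤N))))

seriesMod : ℕ → CommutativeRing 0ℓ 0ℓ
seriesMod N = record
  { Carrier = Series
  ; _≈_ = _≈[ N ]_
  ; _+_ = _⊕_
  ; _*_ = _⊛_
  ; -_  = ⊖_
  ; 0#  = zeroS
  ; 1#  = oneS
  ; isCommutativeRing = record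
    { isRing = record
      { +-isAbelianGroup = record
        { isGroup = record
          { isMonoid = record
            { isSemigroup = record
              { isMagma = record
                { isEquivalence = record
                  { refl  = exact λ _ → ≡.refl
                  ; sym   = λ p → coeffs λ n n≤N → ≡.sym (coeff p n n≤N)
                  ; trans = λ p q → coeffs λ n n≤N → ≡.trans (coeff p n n≤N) (coeff q n n≤N)
                  }
                ; ∙-cong = λ p q → coeffs λ n n≤N → ≡.cong₂ ℤ._+_ (coeff p n n≤N) (coeff q n n≤N)
                }
              ; assoc = λ f g h → exact λ n → ℤ.+-assoc (f n) (g n) (h n)
              }
            ; identity = (λ f → exact λ n → ℤ.+-identityˡ (f n)) , (λ f → exact λ n → ℤ.+-identityʳ (f n))
            }
          ; inverse = (λ f → exact λ n → ℤ.+-inverseˡ (f n)) , (λ f → exact λ n → ℤ.+-inverseʳ (f n))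
          ; ⁻¹-cong = λ p → coeffs λ n n≤N → ≡.cong ℤ.-_ (coeff p n n≤N)
          }
        ; comm = λ f g → exact λ n → ℤ.+-comm (f n) (g n)
        }
      ; *-cong = ⊛-cong
      ; *-assoc = λ f g h → exact (⊛-assoc f g h)
      ; *-identity = (λ f → exact (⊛-identityˡ f)) , (λ f → exact λ n → ≡.trans (⊛-comm f oneS n) (⊛-identityˡ f n))
      ; distrib = (λ f g h → exact λ n → ≡.trans (⊛-comm f (g ⊕ h) n) (≡.trans (⊛-distribʳ f g h n) (≡.cong₂ ℤ._+_ (⊛-comm g f n) (⊛-comm h f n))))
                , (λ h f g → exact (⊛-distribʳ h f g))
      }
    ; *-comm = λ f g → exact (⊛-comm f g)
    }
  }

X : ℕ → Series
X e n = δ n e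

X-⊛-+ : ∀ e f n → (X e ⊛ f) (e ℕ.+ n) ≡ f n
X-⊛-+ zero    f n = ⊛-identityˡ f n
X-⊛-+ (suc e) f n = begin
  (X (suc e) ⊛ f) (suc (e ℕ.+ n))                                         ≡⟨ ⊛-tlˡ (X (suc e)) f (e ℕ.+ n) ⟩
  + 0 ℤ.* f (suc (e ℕ.+ n)) ℤ.+ (tl (X (suc e)) ⊛ f) (e ℕ.+ n)              ≡⟨ ≡.cong₂ ℤ._+_ (ℤ.*-zeroˡ (f (suc (e ℕ.+ n)))) (⊛-congˡ f (e ℕ.+ n) (λ i _ → δ-suc i e)) ⟩
  + 0 ℤ.+ (X e ⊛ f) (e ℕ.+ n)                                             ≡⟨ ℤ.+-identityˡ _ ⟩
  (X e ⊛ f) (e ℕ.+ n)                                                     ≡⟨ X-⊛-+ e f n ⟩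
  f n                                                                   ∎
  where open ≡.≡-Reasoning

X-⊛-< : ∀ {e n} f → n < e → (X e ⊛ f) n ≡ + 0
X-⊛-< {e} {n} f n<e = sumLt-zero (suc n) λ i i<1+n →
  ≡.trans (≡.cong (ℤ._* f (n ∸ i)) (δ-≢ (ℕ.<⇒≢ (ℕ.<-≤-trans i<1+n n<e)))) (ℤ.*-zeroˡ (f (n ∸ i)))

data Position (e n : ℕ) : Set where
  below : n < e → Position e n
  above : ∀ j → n ≡ e ℕ.+ j → Position e n

position : ∀ e n → Position e n
position e n with n ℕ.<? e
... | yes n<e = below n<e
... | no  n≮e = above (n ∸ e) (≡.sym (ℕ.m+[n∸m]≡n (ℕ.≮⇒≥ n≮e)))

δ-+ : ∀ e m n → δ (e ℕ.+ m) (e ℕ.+ n) ≡ δ m n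
δ-+ zero    m n = ≡.refl
δ-+ (suc e) m n = ≡.trans (δ-suc (e ℕ.+ m) (e ℕ.+ n)) (δ-+ e m n)

X-+ : ∀ {N} d e → X (d ℕ.+ e) ≈[ N ] X d ⊛ X e
X-+ d e = exact λ n → case position d n of λ where
  (below n<d)      → ≡.trans (δ-≢ (ℕ.<⇒≢ (ℕ.<-≤-trans n<d (ℕ.m≤m+n d e)))) (≡.sym (X-⊛-< (X e) n<d))
  (above j ≡.refl)   → ≡.trans (δ-+ d j e) (≡.sym (X-⊛-+ d (X e) j))

X-high : ∀ {N e} → N < e → X e ≈[ N ] zeroS
X-high N<e = coeffs λ n n≤N → δ-≢ (ℕ.<⇒≢ (ℕ.≤-<-trans n≤N N<e))

geomQ-+ : ∀ e n → geomQ e (e ℕ.+ n) ≡ geomQ e n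
geomQ-+ e n with e ∣? e ℕ.+ n | e ∣? n
... | yes _ | yes _ = ≡.refl
... | no  _ | no  _ = ≡.refl
... | yes p | no ¬q = contradiction (∣m+n∣m⇒∣n p ∣-refl) ¬q
... | no ¬p | yes q = contradiction (∣m∣n⇒∣m+n ∣-refl q) ¬p

geomQ-low : ∀ {e n} → n < e → geomQ e n ≡ δ n 0
geomQ-low {e} {zero} _ with e ∣? 0
... | yes _ = ≡.refl
... | no ¬p = contradiction (e ∣0) ¬p
geomQ-low {e} {suc n} n<e with e ∣? suc n
... | yes p = contradiction (∣⇒≤ p) (ℕ.<⇒≱ n<e)
... | no  _ = ≡.refl

geomQ-unfold : ∀ {N} e → 0 < e → geomQ e ≈[ N ] oneS ⊕ X e ⊛ geomQ e
geomQ-unfold e 0<e = exact λ n → case position e n of λ where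
  (below n<e)    → ≡.trans (geomQ-low n<e) (≡.sym (≡.trans (≡.cong (λ x → oneS n ℤ.+ x) (X-⊛-< (geomQ e) n<e)) (ℤ.+-identityʳ (oneS n))))
  (above j ≡.refl) → ≡.trans (geomQ-+ e j) (≡.sym (≡.trans
    (≡.cong₂ ℤ._+_ (δ-≢ {e ℕ.+ j} {0} (ℕ.>⇒≢ (ℕ.<-≤-trans 0<e (ℕ.m≤m+n e j)))) (X-⊛-+ e (geomQ e) j))
    (ℤ.+-identityˡ (geomQ e j))))

-- Theta series

powers : ∀ N → TruncatedPowers (seriesMod N) N
powers N = record
  { X       = X
  ; X-0     = exact λ _ → ≡.refl
  ; X-+     = X-+
  ; X-high  = X-high
  ; inv     = geomQ
  ; inv-step = geomQ-unfold
  }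

∏-finProd : ∀ N F k → Products.∏ (powers N) F k ≡ finProd F k
∏-finProd N F zero    = ≡.refl
∏-finProd N F (suc k) = ≡.cong (_⊛ F k) (∏-finProd N F k)

∑-sumLt : ∀ N F k n → Products.∑ (powers N) F k n ≡ sumLt k (λ i → F i n)
∑-sumLt N F zero    n = ≡.refl
∑-sumLt N F (suc k) n = ≡.cong (ℤ._+ F k n) (∑-sumLt N F k n)

X-⊛-difference : ∀ a d e n → (X a ⊛ (X d ⊕ ⊖ X e)) n ≡ δ n (a ℕ.+ d) ℤ.- δ n (a ℕ.+ e)
X-⊛-difference a d e n with position a n
... | below n<a = ≡.trans (X-⊛-< (X d ⊕ ⊖ X e) n<a) (≡.sym (≡.cong₂ ℤ._-_ (far d) (far e)))
  where
  far : ∀ d → δ n (a ℕ.+ d) ≡ + 0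
  far d = δ-≢ (ℕ.<⇒≢ (ℕ.<-≤-trans n<a (ℕ.m≤m+n a d)))
... | above j ≡.refl = ≡.trans (X-⊛-+ a (X d ⊕ ⊖ X e) j) (≡.sym (≡.cong₂ ℤ._-_ (δ-+ a j d) (δ-+ a j e)))

-- theta c is Q_b for b = c + 3; subscripts in names below refer to b.
theta : ℕ → ℕ → Series
theta c K n = sumLt K (λ k → δ n (τ k) ℤ.- δ n (τ k ℕ.+ (1 ℕ.+ b ℕ.* k)))
        ℤ.+ sumLt K (λ k → δ n (σ k ℕ.+ b ℕ.* suc k) ℤ.- δ n (σ k ℕ.+ 1))
  where open Exponents c

Θ-theta : ∀ N c K n → QuintupleProduct.Θ (powers N) c K n ≡ theta c K n
Θ-theta N c K n = ≡.cong₂ ℤ._+_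
  (≡.trans (∑-sumLt N _ K n) (sumLt-cong K λ k _ → ≡.trans (X-⊛-difference (τ k) 0 (1 ℕ.+ b ℕ.* k) n)
    (≡.cong (λ e → δ n e ℤ.- δ n (τ k ℕ.+ (1 ℕ.+ b ℕ.* k))) (ℕ.+-identityʳ (τ k)))))
  (≡.trans (∑-sumLt N _ K n) (sumLt-cong K λ k _ → X-⊛-difference (σ k) (b ℕ.* suc k) 1 n))
  where open Exponents c

productTr : ℕ → ℕ → Series
productTr c K = pochTr 1 b K ⊛ pochTr (2 ℕ.+ c) b K ⊛ pochTr b b K ⊛ pochTr (1 ℕ.+ c) (b ℕ.* 2) K ⊛ pochTr (2 ℕ.+ b) (b ℕ.* 2) K
  where open Exponents c

poch-pochTr : ∀ N a b k → Products.poch (powers N) a b k ≡ pochTr a b k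
poch-pochTr N a b k = ∏-finProd N (λ i → oneMinusQ (a ℕ.+ b ℕ.* i)) k

product-productTr : ∀ N c K → QuintupleProduct.product (powers N) c K ≡ productTr c K
product-productTr N c K = ⊛-cong₅
  (poch-pochTr N 1 b K) (poch-pochTr N (2 ℕ.+ c) b K) (poch-pochTr N b b K)
  (poch-pochTr N (1 ℕ.+ c) (b ℕ.* 2) K) (poch-pochTr N (2 ℕ.+ b) (b ℕ.* 2) K)
  where
  open Exponents c
  ⊛-cong₅ : ∀ {f₁ f₂ f₃ f₄ f₅ g₁ g₂ g₃ g₄ g₅ : Series} → f₁ ≡ g₁ → f₂ ≡ g₂ → f₃ ≡ g₃ → f₄ ≡ g₄ → f₅ ≡ g₅ →
    f₁ ⊛ f₂ ⊛ f₃ ⊛ f₄ ⊛ f₅ ≡ g₁ ⊛ g₂ ⊛ g₃ ⊛ g₄ ⊛ g₅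
  ⊛-cong₅ ≡.refl ≡.refl ≡.refl ≡.refl ≡.refl = ≡.refl

module _ {N : ℕ} where
  open CommutativeRing (seriesMod N)

  theta-product : ∀ c {K} → N < K → theta c K ≈[ N ] productTr c K
  theta-product c {K} N<K = trans (exact (λ n → ≡.sym (Θ-theta N c K n)))
    (trans (QuintupleProduct.quintuple (powers N) c N<K) (reflexive (product-productTr N c K)))

  theta-stable : ∀ c {K L} → N < K → N < L → theta c K ≈[ N ] theta c L
  theta-stable c {K} {L} N<K N<L = trans (exact (λ n → ≡.sym (Θ-theta N c K n)))
    (trans (QuintupleProduct.Θ-stable (powers N) c N<K N<K N<L N<L) (exact (Θ-theta N c L)))

  -- Both sides are (q;q)_∞.
  theta₄-theta₅ : ∀ {K} → N < K → theta 1 K ≈[ N ] theta 2 K ⊛ pochTr 2 10 K ⊛ pochTr 8 10 K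
  theta₄-theta₅ {K} N<K = begin
    theta 1 K
      ≈⟨ trans (theta-product 1 N<K) (sym (reflexive (product-productTr N 1 K))) ⟩
    QuintupleProduct.product (powers N) 1 K
      ≈⟨ trans (product₄ N<K) (sym (product₅ N<K)) ⟩
    QuintupleProduct.product (powers N) 2 K ⊛ Products.poch (powers N) 2 10 K ⊛ Products.poch (powers N) 8 10 K
      ≈⟨ ⊛-cong (⊛-cong (trans (reflexive (product-productTr N 2 K)) (sym (theta-product 2 N<K))) (reflexive (poch-pochTr N 2 10 K))) (reflexive (poch-pochTr N 8 10 K)) ⟩
    theta 2 K ⊛ pochTr 2 10 K ⊛ pochTr 8 10 K ∎
    where
    open ProductIdentities (powers N)
    open SetoidReasoning setoid

-- Even parts

open +-*-Solver using (Polynomial; solve; prove; ⟦_⟧; ⟦_⟧↓; var; con; _:+_; _:*_; _:=_)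

even : Series → Series
even f n = f (double n)

double-mono-≤ : ∀ {m n} → m ≤ n → double m ≤ double n
double-mono-≤ z≤n       = z≤n
double-mono-≤ (s≤s m≤n) = s≤s (s≤s (double-mono-≤ m≤n))

double-mono-< : ∀ {m n} → m < n → double m < double n
double-mono-< m<n = ℕ.<-≤-trans (s≤s (ℕ.n≤1+n _)) (double-mono-≤ m<n)

double-distrib-+ : ∀ m n → double (m ℕ.+ n) ≡ double m ℕ.+ double n
double-distrib-+ zero    n = ≡.refl
double-distrib-+ (suc m) n = ≡.cong (suc ∘ suc) (double-distrib-+ m n)

-- Coefficient n of the even part is coefficient 2n of the series. Precision N after taking even
-- parts thus costs precision 2N before, the source of all bounds `double N < k` below.
even-cong : ∀ {N f g} → f ≈[ double N ] g → even f ≈[ N ] even g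
even-cong f≈g = coeffs λ n n≤N → coeff f≈g (double n) (double-mono-≤ n≤N)

⊛-oneMinusQ : ∀ f e n → (f ⊛ oneMinusQ e) n ≡ f n ℤ.- (X e ⊛ f) n
⊛-oneMinusQ f e n = coeff (*-1- (seriesMod n) f (X e)) n ℕ.≤-refl

-- Multiplication by an even power x^(2e) moves even coefficients only to even coefficients, so an
-- even factor can be taken out of the even part.
even-⊛-oneMinusQ : ∀ f e n → even (f ⊛ oneMinusQ (double e)) n ≡ (even f ⊛ oneMinusQ e) n
even-⊛-oneMinusQ f e n = ≡.trans (⊛-oneMinusQ f (double e) (double n))
  (≡.trans (≡.cong (λ x → f (double n) ℤ.- x) (shift (position e n))) (≡.sym (⊛-oneMinusQ (even f) e n)))
  where
  shift : Position e n → (X (double e) ⊛ f) (double n) ≡ (X e ⊛ even f) n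
  shift (below n<e)      = ≡.trans (X-⊛-< f (double-mono-< n<e)) (≡.sym (X-⊛-< (even f) n<e))
  shift (above j ≡.refl) = ≡.trans (≡.cong (X (double e) ⊛ f) (double-distrib-+ e j))
    (≡.trans (X-⊛-+ (double e) f (double j)) (≡.sym (X-⊛-+ e (even f) j)))

even-⊛-pochTr : ∀ {N} f a b a′ b′ k → (∀ i → a′ ℕ.+ b′ ℕ.* i ≡ double (a ℕ.+ b ℕ.* i)) →
  even (f ⊛ pochTr a′ b′ k) ≈[ N ] even f ⊛ pochTr a b k
even-⊛-pochTr {N} f a b a′ b′ zero eq = trans (even-cong {f = f ⊛ oneS} {g = f} (R′.*-identityʳ f)) (sym (*-identityʳ (even f)))
  where
  open CommutativeRing (seriesMod N)
  module R′ = CommutativeRing (seriesMod (double N))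
even-⊛-pochTr {N} f a b a′ b′ (suc k) eq = begin
  even (f ⊛ (g ⊛ oneMinusQ (a′ ℕ.+ b′ ℕ.* k)))                  ≡⟨ ≡.cong (λ e → even (f ⊛ (g ⊛ oneMinusQ e))) (eq k) ⟩
  even (f ⊛ (g ⊛ oneMinusQ (double (a ℕ.+ b ℕ.* k))))           ≈⟨ even-cong {f = f ⊛ g ⊛ h′} {g = f ⊛ (g ⊛ h′)} (R′.*-assoc f g h′) ⟨
  even (f ⊛ g ⊛ oneMinusQ (double (a ℕ.+ b ℕ.* k)))             ≈⟨ exact (even-⊛-oneMinusQ (f ⊛ g) (a ℕ.+ b ℕ.* k)) ⟩
  even (f ⊛ g) ⊛ h                                              ≈⟨ ⊛-cong (even-⊛-pochTr f a b a′ b′ k eq) (refl {h}) ⟩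
  even f ⊛ pochTr a b k ⊛ h                                     ≈⟨ *-assoc (even f) (pochTr a b k) h ⟩
  even f ⊛ pochTr a b (suc k)                                   ∎
  where
  open CommutativeRing (seriesMod N)
  module R′ = CommutativeRing (seriesMod (double N))
  open SetoidReasoning setoid
  g h h′ : Series
  g  = pochTr a′ b′ k
  h  = oneMinusQ (a ℕ.+ b ℕ.* k)
  h′ = oneMinusQ (double (a ℕ.+ b ℕ.* k))

triangle-double : ∀ t → triangle (double t) ≡ 4 ℕ.* triangle t ℕ.+ t
triangle-double zero    = ≡.refl
triangle-double (suc t) rewrite triangle-double t | double-+ t = eq (triangle t) t
  where
  eq : ∀ T t → 4 ℕ.* T ℕ.+ t ℕ.+ (t ℕ.+ t) ℕ.+ suc (t ℕ.+ t) ≡ 4 ℕ.* (T ℕ.+ t) ℕ.+ suc t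
  eq = ℕSolver.solve-∀

double-injective : ∀ {m n} → double m ≡ double n → m ≡ n
double-injective {zero}  {zero}  _  = ≡.refl
double-injective {suc m} {suc n} eq = ≡.cong suc (double-injective (ℕ.suc-injective (ℕ.suc-injective eq)))

double≢1+double : ∀ {m n} → double m ≢ suc (double n)
double≢1+double {suc m} {suc n} eq = double≢1+double (ℕ.suc-injective (ℕ.suc-injective eq))

δ-even : ∀ n e {e′} → e′ ≡ e ℕ.+ e → δ (double n) e′ ≡ δ n e
δ-even n e ≡.refl rewrite ≡.sym (double-+ e) with n ℕ.≟ e
... | yes ≡.refl = δ-refl (double n)
... | no  n≢e    = δ-≢ (n≢e ∘ double-injective)

δ-odd : ∀ n e {e′} → e′ ≡ suc (e ℕ.+ e) → δ (double n) e′ ≡ + 0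
δ-odd n e ≡.refl rewrite ≡.sym (double-+ e) = δ-≢ double≢1+double

δ-evenₚ : ∀ {k} (ρ : Vec ℕ k) n e′ e → ⟦ e′ ⟧↓ ρ ≡ ⟦ e :+ e ⟧↓ ρ → δ (double n) (⟦ e′ ⟧ ρ) ≡ δ n (⟦ e ⟧ ρ)
δ-evenₚ ρ n e′ e eq = δ-even n (⟦ e ⟧ ρ) (prove ρ e′ (e :+ e) eq)

δ-oddₚ : ∀ {k} (ρ : Vec ℕ k) n e′ e → ⟦ e′ ⟧↓ ρ ≡ ⟦ con 1 :+ (e :+ e) ⟧↓ ρ → δ (double n) (⟦ e′ ⟧ ρ) ≡ + 0
δ-oddₚ ρ n e′ e eq = δ-odd n (⟦ e ⟧ ρ) (prove ρ e′ (con 1 :+ (e :+ e)) eq)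

T̂ t̂ : Polynomial 2
T̂ = var (# 0)
t̂ = var (# 1)

sumLt-double : ∀ K (F : ℕ → ℤ) → sumLt (double K) F ≡ sumLt K (λ t → F (double t) ℤ.+ F (suc (double t)))
sumLt-double zero    F = ≡.refl
sumLt-double (suc K) F = ≡.trans (ℤ.+-assoc (sumLt (double K) F) _ _) (≡.cong (ℤ._+ (F (double K) ℤ.+ F (suc (double K)))) (sumLt-double K F))

sumLt-neg : ∀ n (f : ℕ → ℤ) → sumLt n (λ i → ℤ.- f i) ≡ ℤ.- sumLt n f
sumLt-neg zero    f = ≡.refl
sumLt-neg (suc n) f = ≡.trans (≡.cong (ℤ._+ (ℤ.- f n)) (sumLt-neg n f)) (≡.sym (ℤ.neg-distrib-+ (sumLt n f) (f n)))

sumLt-minus : ∀ n (f g : ℕ → ℤ) → sumLt n (λ i → f i ℤ.- g i) ≡ sumLt n f ℤ.- sumLt n g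
sumLt-minus n f g = ≡.trans (sumLt-+ n f (λ i → ℤ.- g i)) (≡.cong (λ x → sumLt n f ℤ.+ x) (sumLt-neg n g))

cong₄ : ∀ {a b c d a′ b′ c′ d′ : ℤ} → a ≡ a′ → b ≡ b′ → c ≡ c′ → d ≡ d′ →
  (a ℤ.- b) ℤ.+ (c ℤ.- d) ≡ (a′ ℤ.- b′) ℤ.+ (c′ ℤ.- d′)
cong₄ ≡.refl ≡.refl ≡.refl ≡.refl = ≡.refl

sumLt-shift : ∀ K {F : ℕ → ℤ} → F K ≡ + 0 → sumLt K F ≡ F 0 ℤ.+ sumLt K (F ∘ suc)
sumLt-shift K {F} FK≡0 = ≡.trans (≡.sym (≡.trans (≡.cong (λ x → sumLt K F ℤ.+ x) FK≡0) (ℤ.+-identityʳ (sumLt K F)))) (sumLt-front K F)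

module _ (n : ℕ) where

  -- These are the exponents (s² - 1)/48 for s = 24t + 1, 24t - 1, 24t + 17 and 24t + 7
  -- respectively. The subscript is the coefficient of t beside 24·`triangle t`.
  c₁₃ c₁₁ c₂₉ c₁₉ : ℕ → ℤ
  c₁₃ t = δ n (24 ℕ.* triangle t ℕ.+ 13 ℕ.* t)
  c₁₁ t = δ n (24 ℕ.* triangle t ℕ.+ 11 ℕ.* t)
  c₂₉ t = δ n (24 ℕ.* triangle t ℕ.+ 29 ℕ.* t ℕ.+ 6)
  c₁₉ t = δ n (24 ℕ.* triangle t ℕ.+ 19 ℕ.* t ℕ.+ 1)

  theta₈-expand : ∀ K → theta 5 K n ≡ sumLt K (λ t → c₁₁ t ℤ.- c₁₉ t) ℤ.+ sumLt K (λ t → c₁₃ (suc t) ℤ.- c₂₉ t)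
  theta₈-expand K = ≡.cong₂ ℤ._+_
    (sumLt-cong K λ t _ → ≡.cong (λ e → c₁₁ t ℤ.- δ n e)
      (solve 2 (λ T t → con 24 :* T :+ con 11 :* t :+ (con 1 :+ con 8 :* t) := con 24 :* T :+ con 19 :* t :+ con 1) ≡.refl (triangle t) t))
    (sumLt-cong K λ t _ → ≡.cong₂ (λ d e → δ n d ℤ.- δ n e)
      (solve 2 (λ T t → con 24 :* (T :+ t) :+ con 5 :* t :+ con 5 :+ con 8 :* (con 1 :+ t) := con 24 :* (T :+ t) :+ con 13 :* (con 1 :+ t)) ≡.refl (triangle t) t)
      (solve 2 (λ T t → con 24 :* (T :+ t) :+ con 5 :* t :+ con 5 :+ con 1 := con 24 :* T :+ con 29 :* t :+ con 6) ≡.refl (triangle t) t))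

  -- The exponents for b = 4 are 6k² + k and 6k² + 5k + 1. The first is even for even k and the
  -- second for odd k, so k = 2t and k = 2t + 1 keep one exponent each.
  theta₄-block⁺ : ∀ t → let F = λ k → δ (double n) (Exponents.τ 1 k) ℤ.- δ (double n) (Exponents.τ 1 k ℕ.+ (1 ℕ.+ 4 ℕ.* k)) in
    F (double t) ℤ.+ F (suc (double t)) ≡ c₁₃ t ℤ.- c₂₉ t
  theta₄-block⁺ t rewrite triangle-double t | double-+ t = ≡.trans
    (cong₄
      (δ-evenₚ ρ n (con 12 :* (con 4 :* T̂ :+ t̂) :+ con 7 :* (t̂ :+ t̂)) (con 24 :* T̂ :+ con 13 :* t̂) ≡.refl)
      (δ-oddₚ ρ n (con 12 :* (con 4 :* T̂ :+ t̂) :+ con 7 :* (t̂ :+ t̂) :+ (con 1 :+ con 4 :* (t̂ :+ t̂))) (con 24 :* T̂ :+ con 17 :* t̂) ≡.refl)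
      (δ-oddₚ ρ n (con 12 :* (con 4 :* T̂ :+ t̂ :+ (t̂ :+ t̂)) :+ con 7 :* (con 1 :+ (t̂ :+ t̂))) (con 24 :* T̂ :+ con 25 :* t̂ :+ con 3) ≡.refl)
      (δ-evenₚ ρ n (con 12 :* (con 4 :* T̂ :+ t̂ :+ (t̂ :+ t̂)) :+ con 7 :* (con 1 :+ (t̂ :+ t̂)) :+ (con 1 :+ con 4 :* (con 1 :+ (t̂ :+ t̂)))) (con 24 :* T̂ :+ con 29 :* t̂ :+ con 6) ≡.refl))
    (simplify (c₁₃ t) (c₂₉ t))
    where
    ρ = triangle t ∷ t ∷ []
    simplify : ∀ x y → (x ℤ.- + 0) ℤ.+ (+ 0 ℤ.- y) ≡ x ℤ.- y
    simplify = ℤSolver.solve-∀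

  theta₄-block⁻ : ∀ t → let F = λ k → δ (double n) (Exponents.σ 1 k ℕ.+ 4 ℕ.* suc k) ℤ.- δ (double n) (Exponents.σ 1 k ℕ.+ 1) in
    F (double t) ℤ.+ F (suc (double t)) ≡ c₁₁ (suc t) ℤ.- c₁₉ t
  theta₄-block⁻ t rewrite triangle-double t | double-+ t = ≡.trans
    (cong₄
      (δ-oddₚ ρ n (con 12 :* (con 4 :* T̂ :+ t̂ :+ (t̂ :+ t̂)) :+ con 1 :* (t̂ :+ t̂) :+ con 1 :+ con 4 :* (con 1 :+ (t̂ :+ t̂))) (con 24 :* T̂ :+ con 23 :* t̂ :+ con 2) ≡.refl)
      (δ-evenₚ ρ n (con 12 :* (con 4 :* T̂ :+ t̂ :+ (t̂ :+ t̂)) :+ con 1 :* (t̂ :+ t̂) :+ con 1 :+ con 1) (con 24 :* T̂ :+ con 19 :* t̂ :+ con 1) ≡.refl)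
      (δ-evenₚ ρ n (con 12 :* (con 4 :* T̂ :+ t̂ :+ (t̂ :+ t̂) :+ (con 1 :+ (t̂ :+ t̂))) :+ con 1 :* (con 1 :+ (t̂ :+ t̂)) :+ con 1 :+ con 4 :* (con 1 :+ (con 1 :+ (t̂ :+ t̂)))) (con 24 :* (T̂ :+ t̂) :+ con 11 :* (con 1 :+ t̂)) ≡.refl)
      (δ-oddₚ ρ n (con 12 :* (con 4 :* T̂ :+ t̂ :+ (t̂ :+ t̂) :+ (con 1 :+ (t̂ :+ t̂))) :+ con 1 :* (con 1 :+ (t̂ :+ t̂)) :+ con 1 :+ con 1) (con 24 :* T̂ :+ con 31 :* t̂ :+ con 7) ≡.refl))
    (simplify (c₁₁ (suc t)) (c₁₉ t))
    where
    ρ = triangle t ∷ t ∷ []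
    simplify : ∀ x y → (+ 0 ℤ.- y) ℤ.+ (x ℤ.- + 0) ≡ x ℤ.- y
    simplify = ℤSolver.solve-∀

  theta₄-even : ∀ K → theta 1 (double K) (double n) ≡ sumLt K (λ t → c₁₃ t ℤ.- c₂₉ t) ℤ.+ sumLt K (λ t → c₁₁ (suc t) ℤ.- c₁₉ t)
  theta₄-even K = ≡.cong₂ ℤ._+_
    (≡.trans (sumLt-double K _) (sumLt-cong K λ t _ → theta₄-block⁺ t))
    (≡.trans (sumLt-double K _) (sumLt-cong K λ t _ → theta₄-block⁻ t))

  -- Both sides contain the same four families, but exponent 0 is counted as `c₁₁ 0` on one side and
  -- as `c₁₃ 0` on the other. Moving it shifts two of the sums by one place, and the terms of index
  -- K lost in doing so vanish because K > n.
  theta₈-theta₄ : ∀ K → n < K → theta 5 K n ≡ theta 1 (double K) (double n)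
  theta₈-theta₄ K n<K = begin
    theta 5 K n
      ≡⟨ theta₈-expand K ⟩
    sumLt K (λ t → c₁₁ t ℤ.- c₁₉ t) ℤ.+ sumLt K (λ t → c₁₃ (suc t) ℤ.- c₂₉ t)
      ≡⟨ ≡.cong₂ ℤ._+_ (sumLt-minus K c₁₁ c₁₉) (sumLt-minus K (c₁₃ ∘ suc) c₂₉) ⟩
    (sumLt K c₁₁ ℤ.- sumLt K c₁₉) ℤ.+ (sumLt K (c₁₃ ∘ suc) ℤ.- sumLt K c₂₉)
      ≡⟨ ≡.cong (λ x → (x ℤ.- sumLt K c₁₉) ℤ.+ (sumLt K (c₁₃ ∘ suc) ℤ.- sumLt K c₂₉)) (sumLt-shift K (far 11)) ⟩
    (c₁₃ 0 ℤ.+ sumLt K (c₁₁ ∘ suc) ℤ.- sumLt K c₁₉) ℤ.+ (sumLt K (c₁₃ ∘ suc) ℤ.- sumLt K c₂₉)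
      ≡⟨ regroup (c₁₃ 0) (sumLt K (c₁₁ ∘ suc)) (sumLt K c₁₉) (sumLt K (c₁₃ ∘ suc)) (sumLt K c₂₉) ⟩
    (c₁₃ 0 ℤ.+ sumLt K (c₁₃ ∘ suc) ℤ.- sumLt K c₂₉) ℤ.+ (sumLt K (c₁₁ ∘ suc) ℤ.- sumLt K c₁₉)
      ≡⟨ ≡.cong (λ x → (x ℤ.- sumLt K c₂₉) ℤ.+ (sumLt K (c₁₁ ∘ suc) ℤ.- sumLt K c₁₉)) (sumLt-shift K (far 13)) ⟨
    (sumLt K c₁₃ ℤ.- sumLt K c₂₉) ℤ.+ (sumLt K (c₁₁ ∘ suc) ℤ.- sumLt K c₁₉)
      ≡⟨ ≡.cong₂ ℤ._+_ (sumLt-minus K c₁₃ c₂₉) (sumLt-minus K (c₁₁ ∘ suc) c₁₉) ⟨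
    sumLt K (λ t → c₁₃ t ℤ.- c₂₉ t) ℤ.+ sumLt K (λ t → c₁₁ (suc t) ℤ.- c₁₉ t)
      ≡⟨ theta₄-even K ⟨
    theta 1 (double K) (double n) ∎
    where
    open ≡.≡-Reasoning
    far : ∀ m .{{_ : ℕ.NonZero m}} → δ n (24 ℕ.* triangle K ℕ.+ m ℕ.* K) ≡ + 0
    far m = δ-≢ (ℕ.<⇒≢ (ℕ.<-≤-trans n<K (ℕ.≤-trans (ℕ.m≤n*m K m) (ℕ.m≤n+m _ (24 ℕ.* triangle K)))))
    regroup : ∀ a b c d e → (a ℤ.+ b ℤ.- c) ℤ.+ (d ℤ.- e) ≡ (a ℤ.+ d ℤ.- e) ℤ.+ (b ℤ.- c)
    regroup = ℤSolver.solve-∀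

-- The sequence (a_n)

-- The s with s² ≡ 1 (mod 240) are those with s ≡ ±1, ±31, ±41, ±49 (mod 120).
root : ℕ → ℕ
root 0 = 1
root 1 = 31
root 2 = 41
root 3 = 49
root 4 = 71
root 5 = 79
root 6 = 89
root 7 = 119
root (suc (suc (suc (suc (suc (suc (suc (suc n)))))))) = 120 ℕ.+ root n

-- The value (s² - 1)/240 for s = `root n`. As (s + 120)² = s² + 240(s + 60), a full period of eight
-- indices adds s + 60.
A : ℕ → ℕ
A 0 = 0
A 1 = 4
A 2 = 7
A 3 = 10
A 4 = 21
A 5 = 26
A 6 = 33
A 7 = 59
A (suc (suc (suc (suc (suc (suc (suc (suc n)))))))) = A n ℕ.+ root n ℕ.+ 60

root-A : ∀ n → root n ℕ.* root n ≡ 240 ℕ.* A n ℕ.+ 1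
root-A 0 = ≡.refl
root-A 1 = ≡.refl
root-A 2 = ≡.refl
root-A 3 = ≡.refl
root-A 4 = ≡.refl
root-A 5 = ≡.refl
root-A 6 = ≡.refl
root-A 7 = ≡.refl
root-A (suc (suc (suc (suc (suc (suc (suc (suc n)))))))) = begin
  (120 ℕ.+ root n) ℕ.* (120 ℕ.+ root n)                         ≡⟨ square (root n) ⟩
  root n ℕ.* root n ℕ.+ 240 ℕ.* (root n ℕ.+ 60)                 ≡⟨ ≡.cong (ℕ._+ 240 ℕ.* (root n ℕ.+ 60)) (root-A n) ⟩
  240 ℕ.* A n ℕ.+ 1 ℕ.+ 240 ℕ.* (root n ℕ.+ 60)                 ≡⟨ collect (A n) (root n) ⟩
  240 ℕ.* (A n ℕ.+ root n ℕ.+ 60) ℕ.+ 1                         ∎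
  where
  open ≡.≡-Reasoning
  square : ∀ s → (120 ℕ.+ s) ℕ.* (120 ℕ.+ s) ≡ s ℕ.* s ℕ.+ 240 ℕ.* (s ℕ.+ 60)
  square = solve 1 (λ s → (con 120 :+ s) :* (con 120 :+ s) := s :* s :+ con 240 :* (s :+ con 60)) ≡.refl
  collect : ∀ a s → 240 ℕ.* a ℕ.+ 1 ℕ.+ 240 ℕ.* (s ℕ.+ 60) ≡ 240 ℕ.* (a ℕ.+ s ℕ.+ 60) ℕ.+ 1
  collect = solve 2 (λ a s → con 240 :* a :+ con 1 :+ con 240 :* (s :+ con 60) := con 240 :* (a :+ s :+ con 60) :+ con 1) ≡.refl

root-increasing : ∀ n → root n < root (suc n)
root-increasing 0 = toWitness {a? = 1 ℕ.<? 31} _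
root-increasing 1 = toWitness {a? = 31 ℕ.<? 41} _
root-increasing 2 = toWitness {a? = 41 ℕ.<? 49} _
root-increasing 3 = toWitness {a? = 49 ℕ.<? 71} _
root-increasing 4 = toWitness {a? = 71 ℕ.<? 79} _
root-increasing 5 = toWitness {a? = 79 ℕ.<? 89} _
root-increasing 6 = toWitness {a? = 89 ℕ.<? 119} _
root-increasing 7 = toWitness {a? = 119 ℕ.<? 121} _
root-increasing (suc (suc (suc (suc (suc (suc (suc (suc n)))))))) = ℕ.+-monoʳ-< 120 (root-increasing n)

Increasing : (ℕ → ℕ) → Set
Increasing a = ∀ m n → m < n → a m < a n

increasing : ∀ {a} → (∀ n → a n < a (suc n)) → Increasing a
increasing step m (suc n) (s≤s m≤n) with ℕ.m≤n⇒m<n∨m≡n m≤n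
... | inj₁ m<n    = ℕ.<-trans (increasing step m n m<n) (step n)
... | inj₂ ≡.refl = step n

increasing-≤ : ∀ {a} → Increasing a → ∀ {m n} → m ≤ n → a m ≤ a n
increasing-≤ inc {m} {n} m≤n with ℕ.m≤n⇒m<n∨m≡n m≤n
... | inj₁ m<n    = ℕ.<⇒≤ (inc m n m<n)
... | inj₂ ≡.refl = ℕ.≤-refl

increasing-≥id : ∀ {a} → Increasing a → ∀ n → n ≤ a n
increasing-≥id inc zero    = z≤n
increasing-≥id inc (suc n) = ℕ.≤-<-trans (increasing-≥id inc n) (inc n (suc n) ℕ.≤-refl)

A-increasing : Increasing A
A-increasing = increasing λ n → ℕ.*-cancelˡ-< 240 (A n) (A (suc n)) (ℕ.+-cancelʳ-< 1 _ _
  (≡.subst₂ _<_ (root-A n) (root-A (suc n)) (ℕ.*-mono-< (root-increasing n) (root-increasing n))))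

eightfold : ℕ → ℕ
eightfold t = double (double (double t))

root-eightfold : ∀ t r → root (eightfold t ℕ.+ r) ≡ 120 ℕ.* t ℕ.+ root r
root-eightfold zero    r = ≡.refl
root-eightfold (suc t) r = ≡.trans (≡.cong (120 ℕ.+_) (root-eightfold t r)) (eq t (root r))
  where
  eq : ∀ t s → 120 ℕ.+ (120 ℕ.* t ℕ.+ s) ≡ 120 ℕ.* (1 ℕ.+ t) ℕ.+ s
  eq = solve 2 (λ t s → con 120 :+ (con 120 :* t :+ s) := con 120 :* (con 1 :+ t) :+ s) ≡.refl

A-eightfold : ∀ t r → A (eightfold t ℕ.+ r) ≡ 120 ℕ.* triangle t ℕ.+ (60 ℕ.+ root r) ℕ.* t ℕ.+ A r
A-eightfold zero    r = ≡.sym (≡.cong (ℕ._+ A r) (ℕ.*-zeroʳ (60 ℕ.+ root r)))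
A-eightfold (suc t) r = ≡.trans
  (≡.cong₂ (λ a s → a ℕ.+ s ℕ.+ 60) (A-eightfold t r) (root-eightfold t r))
  (eq (triangle t) t (root r) (A r))
  where
  eq : ∀ T t s a → 120 ℕ.* T ℕ.+ (60 ℕ.+ s) ℕ.* t ℕ.+ a ℕ.+ (120 ℕ.* t ℕ.+ s) ℕ.+ 60 ≡ 120 ℕ.* (T ℕ.+ t) ℕ.+ (60 ℕ.+ s) ℕ.* (1 ℕ.+ t) ℕ.+ a
  eq = solve 4 (λ T t s a → con 120 :* T :+ (con 60 :+ s) :* t :+ a :+ (con 120 :* t :+ s) :+ con 60
         := con 120 :* (T :+ t) :+ (con 60 :+ s) :* (con 1 :+ t) :+ a) ≡.refl

residues : ∀ (r : Fin 120) → (toℕ r ℕ.* toℕ r) % 240 ≡ 1 → ∃ λ (i : Fin 8) → root (toℕ i) ≡ toℕ r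
residues = toWitness {a? = Fin.all? λ r → ((toℕ r ℕ.* toℕ r) % 240 ℕ.≟ 1) →-dec Fin.any? λ i → root (toℕ i) ℕ.≟ toℕ r} _

root-residue : ∀ {r} → r < 120 → (r ℕ.* r) % 240 ≡ 1 → ∃ λ i → root i ≡ r
root-residue {r} r<120 r²≡1 =
  let i , eq = residues (Fin.fromℕ< r<120) (≡.trans (≡.cong (λ r → (r ℕ.* r) % 240) (Fin.toℕ-fromℕ< r<120)) r²≡1)
  in toℕ i , ≡.trans eq (Fin.toℕ-fromℕ< r<120)

-- (r + 120t)² = r² + 240(rt + 60t²), so the residue modulo 120 already determines the square modulo
-- 240, and a check of 120 residues suffices.
square-residue : ∀ m s → s ℕ.* s ≡ 240 ℕ.* m ℕ.+ 1 → (s % 120 ℕ.* (s % 120)) % 240 ≡ 1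
square-residue m s s² = begin
  (r ℕ.* r) % 240                                                       ≡⟨ [m+kn]%n≡m%n (r ℕ.* r) (t ℕ.* r ℕ.+ t ℕ.* t ℕ.* 60) 240 ⟨
  (r ℕ.* r ℕ.+ (t ℕ.* r ℕ.+ t ℕ.* t ℕ.* 60) ℕ.* 240) % 240              ≡⟨ ≡.cong (_% 240) (expand r t) ⟨
  ((r ℕ.+ t ℕ.* 120) ℕ.* (r ℕ.+ t ℕ.* 120)) % 240                       ≡⟨ ≡.cong (λ s → (s ℕ.* s) % 240) (m≡m%n+[m/n]*n s 120) ⟨
  (s ℕ.* s) % 240                                                       ≡⟨ ≡.cong (_% 240) s² ⟩
  (240 ℕ.* m ℕ.+ 1) % 240                                               ≡⟨ ≡.cong (_% 240) (≡.trans (ℕ.+-comm (240 ℕ.* m) 1) (≡.cong (1 ℕ.+_) (ℕ.*-comm 240 m))) ⟩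
  (1 ℕ.+ m ℕ.* 240) % 240                                               ≡⟨ [m+kn]%n≡m%n 1 m 240 ⟩
  1                                                                     ∎
  where
  open ≡.≡-Reasoning
  r = s % 120
  t = s / 120
  expand : ∀ r t → (r ℕ.+ t ℕ.* 120) ℕ.* (r ℕ.+ t ℕ.* 120) ≡ r ℕ.* r ℕ.+ (t ℕ.* r ℕ.+ t ℕ.* t ℕ.* 60) ℕ.* 240
  expand = solve 2 (λ r t → (r :+ t :* con 120) :* (r :+ t :* con 120) := r :* r :+ (t :* r :+ t :* t :* con 60) :* con 240) ≡.refl

square-root : ∀ m s n → s ℕ.* s ≡ 240 ℕ.* m ℕ.+ 1 → root n ≡ s → A n ≡ m
square-root m s n s² ≡.refl = ℕ.*-cancelˡ-≡ (A n) m 240 (ℕ.+-cancelʳ-≡ 1 _ _ (≡.trans (≡.sym (root-A n)) s²))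

IsA⇒A : ∀ m → IsA m → ∃ λ n → A n ≡ m
IsA⇒A m (s , s²) =
  let i , eq = root-residue (m%n<n s 120) (square-residue m s s²)
  -- The roots come in blocks of eight, one block for each quotient by 120; the residue fixes the
  -- place inside the block.
  in eightfold (s / 120) ℕ.+ i , square-root m s (eightfold (s / 120) ℕ.+ i) s² (root-n i eq)
  where
  open ≡.≡-Reasoning
  root-n : ∀ i → root i ≡ s % 120 → root (eightfold (s / 120) ℕ.+ i) ≡ s
  root-n i eq = begin
    root (eightfold (s / 120) ℕ.+ i)        ≡⟨ root-eightfold (s / 120) i ⟩
    120 ℕ.* (s / 120) ℕ.+ root i            ≡⟨ ≡.cong₂ ℕ._+_ (ℕ.*-comm 120 (s / 120)) eq ⟩
    s / 120 ℕ.* 120 ℕ.+ s % 120             ≡⟨ ℕ.+-comm (s / 120 ℕ.* 120) (s % 120) ⟩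
    s % 120 ℕ.+ s / 120 ℕ.* 120             ≡⟨ m≡m%n+[m/n]*n s 120 ⟨
    s                                       ∎

-- If a = a′ ∘ j with a and a′ increasing, then j is increasing, so j n ≥ n.
enumeration-≤ : ∀ {a a′} → Increasing a → Increasing a′ → (∀ n → ∃ λ j → a′ j ≡ a n) → ∀ n → a′ n ≤ a n
enumeration-≤ {a} {a′} inc inc′ sub n = ≡.subst (a′ n ≤_) (proj₂ (sub n)) (increasing-≤ inc′ (increasing-≥id j-increasing n))
  where
  j : ℕ → ℕ
  j n = proj₁ (sub n)
  j-increasing : Increasing j
  j-increasing m n m<n = ℕ.≰⇒> λ jn≤jm → ℕ.<⇒≱ (inc m n m<n)
    (≡.subst₂ _≤_ (proj₂ (sub n)) (proj₂ (sub m)) (increasing-≤ inc′ jn≤jm))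

enumeration-unique : ∀ {P a a′} → ListsIncreasing P a → ListsIncreasing P a′ → ∀ n → a n ≡ a′ n
enumeration-unique (inc , all , sound) (inc′ , all′ , sound′) n = ℕ.≤-antisym
  (enumeration-≤ inc′ inc (λ n → all _ (sound′ n)) n)
  (enumeration-≤ inc inc′ (λ n → all′ _ (sound n)) n)

A-lists : ListsIncreasing IsA A
A-lists = A-increasing , IsA⇒A , λ n → root n , root-A n

sgn-period : ∀ n → sgn (8 ℕ.+ n) ≡ sgn n
sgn-period n = begin
  ε ℤ.^ ((8 ℕ.+ (n ℕ.+ 2)) / 4)             ≡⟨ ≡.cong (ε ℤ.^_) (+-distrib-/-∣ˡ {8} (n ℕ.+ 2) {4} (divides 2 ≡.refl)) ⟩
  ε ℤ.* (ε ℤ.* ε ℤ.^ ((n ℕ.+ 2) / 4))       ≡⟨ ≡.trans (ℤ.-1*i≡-i (ε ℤ.* p)) (≡.cong ℤ.-_ (ℤ.-1*i≡-i p)) ⟩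
  ℤ.- ℤ.- (ε ℤ.^ ((n ℕ.+ 2) / 4))           ≡⟨ ℤ.neg-involutive p ⟩
  ε ℤ.^ ((n ℕ.+ 2) / 4)                     ∎
  where
  open ≡.≡-Reasoning
  ε p : ℤ
  ε = ℤ.- (+ 1)
  p = ε ℤ.^ ((n ℕ.+ 2) / 4)

sgn-eightfold : ∀ t r → sgn (eightfold t ℕ.+ r) ≡ sgn r
sgn-eightfold zero    r = ≡.refl
sgn-eightfold (suc t) r = ≡.trans (sgn-period (eightfold t ℕ.+ r)) (sgn-eightfold t r)

δ-sym : ∀ m n → δ m n ≡ δ n m
δ-sym m n with m ℕ.≟ n
... | yes ≡.refl = ≡.sym (δ-refl n)
... | no  m≢n    = ≡.sym (δ-≢ (m≢n ∘ ≡.sym))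

-- For b = 5 the parity of the exponents, such as (15k² + k)/2, has period 4 in k, so even parts are
-- taken over blocks of four indices.
fourfold : (ℕ → ℤ) → ℕ → ℤ
fourfold F t = (F k ℤ.+ F (1 ℕ.+ k)) ℤ.+ (F (2 ℕ.+ k) ℤ.+ F (3 ℕ.+ k))
  where k = double (double t)

sumLt-fourfold : ∀ K F → sumLt (double (double K)) F ≡ sumLt K (fourfold F)
sumLt-fourfold K F = ≡.trans (sumLt-double (double K) F) (sumLt-double K _)

-- The index 4t + r, its triangle, and the exponents τ and σ for b = 5 there, in terms of t and triangle t.
k̂ T̂ᵣ τ̂ σ̂ : ℕ → Polynomial 2
k̂ r = con r :+ (t̂ :+ t̂ :+ (t̂ :+ t̂))
T̂ᵣ zero    = con 4 :* (con 4 :* T̂ :+ t̂) :+ (t̂ :+ t̂)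
T̂ᵣ (suc r) = T̂ᵣ r :+ k̂ r
τ̂ r = con 15 :* T̂ᵣ r :+ con 8 :* k̂ r
σ̂ r = con 15 :* (T̂ᵣ r :+ k̂ r) :+ con 2 :* k̂ r :+ con 2

ê : ℕ → ℕ → ℕ → Polynomial 2
ê u v w = con u :* T̂ :+ con v :* t̂ :+ con w

module _ (n : ℕ) where

  χ : ℕ → ℕ → ℤ
  χ t r = δ n (120 ℕ.* triangle t ℕ.+ (60 ℕ.+ root r) ℕ.* t ℕ.+ A r)

  -- Of the eight exponents in a block four are even, and their halves are 120·`triangle t` + (60 +
  -- `root r`)·t + `A r` for r = 0, 1, 2, 4; the negative half supplies r = 3, 5, 6, 7. For an odd
  -- exponent the polynomial `ê` is half of its predecessor.
  theta₅-block⁺ : ∀ t → fourfold (λ k → δ (double n) (Exponents.τ 2 k) ℤ.- δ (double n) (Exponents.τ 2 k ℕ.+ (1 ℕ.+ 5 ℕ.* k))) t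
    ≡ χ t 0 ℤ.+ χ t 1 ℤ.- χ t 2 ℤ.- χ t 4
  theta₅-block⁺ t rewrite triangle-double (double t) | triangle-double t | double-+ (double t) | double-+ t = ≡.trans
    (≡.cong₂ ℤ._+_
      (cong₄ (δ-evenₚ ρ n (τ̂ 0) (ê 120 61 0) ≡.refl) (δ-oddₚ ρ n (τ̂ 0 :+ (con 1 :+ con 5 :* k̂ 0)) (ê 120 71 0) ≡.refl)
             (δ-evenₚ ρ n (τ̂ 1) (ê 120 91 4) ≡.refl) (δ-evenₚ ρ n (τ̂ 1 :+ (con 1 :+ con 5 :* k̂ 1)) (ê 120 101 7) ≡.refl))
      (cong₄ (δ-oddₚ ρ n (τ̂ 2) (ê 120 121 15) ≡.refl) (δ-evenₚ ρ n (τ̂ 2 :+ (con 1 :+ con 5 :* k̂ 2)) (ê 120 131 21) ≡.refl)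
             (δ-oddₚ ρ n (τ̂ 3) (ê 120 151 34) ≡.refl) (δ-oddₚ ρ n (τ̂ 3 :+ (con 1 :+ con 5 :* k̂ 3)) (ê 120 161 42) ≡.refl)))
    (simplify (χ t 0) (χ t 1) (χ t 2) (χ t 4))
    where
    ρ = triangle t ∷ t ∷ []
    simplify : ∀ x₀ x₁ x₂ x₄ → (x₀ ℤ.- + 0) ℤ.+ (x₁ ℤ.- x₂) ℤ.+ ((+ 0 ℤ.- x₄) ℤ.+ (+ 0 ℤ.- + 0)) ≡ x₀ ℤ.+ x₁ ℤ.- x₂ ℤ.- x₄
    simplify = ℤSolver.solve-∀

  theta₅-block⁻ : ∀ t → fourfold (λ k → δ (double n) (Exponents.σ 2 k ℕ.+ 5 ℕ.* suc k) ℤ.- δ (double n) (Exponents.σ 2 k ℕ.+ 1)) t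
    ≡ χ t 7 ℤ.+ χ t 6 ℤ.- χ t 5 ℤ.- χ t 3
  theta₅-block⁻ t rewrite triangle-double (double t) | triangle-double t | double-+ (double t) | double-+ t = ≡.trans
    (≡.cong₂ ℤ._+_
      (cong₄ (δ-oddₚ ρ n (σ̂ 0 :+ con 5 :* k̂ 1) (ê 120 89 3) ≡.refl) (δ-oddₚ ρ n (σ̂ 0 :+ con 1) (ê 120 79 1) ≡.refl)
             (δ-oddₚ ρ n (σ̂ 1 :+ con 5 :* k̂ 2) (ê 120 119 14) ≡.refl) (δ-evenₚ ρ n (σ̂ 1 :+ con 1) (ê 120 109 10) ≡.refl))
      (cong₄ (δ-evenₚ ρ n (σ̂ 2 :+ con 5 :* k̂ 3) (ê 120 149 33) ≡.refl) (δ-evenₚ ρ n (σ̂ 2 :+ con 1) (ê 120 139 26) ≡.refl)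
             (δ-evenₚ ρ n (σ̂ 3 :+ con 5 :* k̂ 4) (ê 120 179 59) ≡.refl) (δ-oddₚ ρ n (σ̂ 3 :+ con 1) (ê 120 169 49) ≡.refl)))
    (simplify (χ t 3) (χ t 5) (χ t 6) (χ t 7))
    where
    ρ = triangle t ∷ t ∷ []
    simplify : ∀ x₃ x₅ x₆ x₇ → (+ 0 ℤ.- + 0) ℤ.+ (+ 0 ℤ.- x₃) ℤ.+ ((x₆ ℤ.- x₅) ℤ.+ (x₇ ℤ.- + 0)) ≡ x₇ ℤ.+ x₆ ℤ.- x₅ ℤ.- x₃
    simplify = ℤSolver.solve-∀

  signed : ℕ → ℤ
  signed m = sgn m ℤ.* δ (A m) n

  signed-eightfold : ∀ t r → signed (r ℕ.+ eightfold t) ≡ sgn r ℤ.* χ t r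
  signed-eightfold t r rewrite ℕ.+-comm r (eightfold t) =
    ≡.cong₂ ℤ._*_ (sgn-eightfold t r) (≡.trans (≡.cong (λ e → δ e n) (A-eightfold t r)) (δ-sym _ n))

  signed⁺ : ∀ t r → sgn r ≡ + 1 → signed (r ℕ.+ eightfold t) ≡ χ t r
  signed⁺ t r eq = ≡.trans (signed-eightfold t r) (≡.trans (≡.cong (ℤ._* χ t r) eq) (ℤ.*-identityˡ (χ t r)))

  signed⁻ : ∀ t r → sgn r ≡ ℤ.- (+ 1) → signed (r ℕ.+ eightfold t) ≡ ℤ.- χ t r
  signed⁻ t r eq = ≡.trans (signed-eightfold t r) (≡.trans (≡.cong (ℤ._* χ t r) eq) (ℤ.-1*i≡-i (χ t r)))

  -- One block of four indices in each half of the theta series matches one period of eight terms of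
  -- the sequence. The signs for r = 0, ..., 7 are + + - - - - + +, which is the pattern of the
  -- floor function in `sgn`.
  sequence-theta₅ : ∀ K → lhsTr A (eightfold K) n ≡ even (theta 2 (double (double K))) n
  sequence-theta₅ K = begin
    sumLt (eightfold K) signed
      ≡⟨ ≡.trans (sumLt-fourfold (double K) signed) (sumLt-double K (fourfold signed)) ⟩
    sumLt K (λ t → fourfold signed (double t) ℤ.+ fourfold signed (suc (double t)))
      ≡⟨ sumLt-cong K (λ t _ → ≡.trans (≡.cong₂ ℤ._+_
           (≡.cong₂ ℤ._+_ (≡.cong₂ ℤ._+_ (signed⁺ t 0 ≡.refl) (signed⁺ t 1 ≡.refl)) (≡.cong₂ ℤ._+_ (signed⁻ t 2 ≡.refl) (signed⁻ t 3 ≡.refl)))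
           (≡.cong₂ ℤ._+_ (≡.cong₂ ℤ._+_ (signed⁻ t 4 ≡.refl) (signed⁻ t 5 ≡.refl)) (≡.cong₂ ℤ._+_ (signed⁺ t 6 ≡.refl) (signed⁺ t 7 ≡.refl))))
           (regroup (χ t 0) (χ t 1) (χ t 2) (χ t 3) (χ t 4) (χ t 5) (χ t 6) (χ t 7))) ⟩
    sumLt K (λ t → (χ t 0 ℤ.+ χ t 1 ℤ.- χ t 2 ℤ.- χ t 4) ℤ.+ (χ t 7 ℤ.+ χ t 6 ℤ.- χ t 5 ℤ.- χ t 3))
      ≡⟨ sumLt-+ K _ _ ⟩
    sumLt K (λ t → χ t 0 ℤ.+ χ t 1 ℤ.- χ t 2 ℤ.- χ t 4) ℤ.+ sumLt K (λ t → χ t 7 ℤ.+ χ t 6 ℤ.- χ t 5 ℤ.- χ t 3)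
      ≡⟨ ≡.cong₂ ℤ._+_ (≡.trans (sumLt-fourfold K _) (sumLt-cong K λ t _ → theta₅-block⁺ t))
                       (≡.trans (sumLt-fourfold K _) (sumLt-cong K λ t _ → theta₅-block⁻ t)) ⟨
    theta 2 (double (double K)) (double n) ∎
    where
    open ≡.≡-Reasoning
    regroup : ∀ x₀ x₁ x₂ x₃ x₄ x₅ x₆ x₇ →
      x₀ ℤ.+ x₁ ℤ.+ (ℤ.- x₂ ℤ.+ ℤ.- x₃) ℤ.+ (ℤ.- x₄ ℤ.+ ℤ.- x₅ ℤ.+ (x₆ ℤ.+ x₇)) ≡
      (x₀ ℤ.+ x₁ ℤ.- x₂ ℤ.- x₄) ℤ.+ (x₇ ℤ.+ x₆ ℤ.- x₅ ℤ.- x₃)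
    regroup = ℤSolver.solve-∀

-- Comparison of the two sides

sumLt-extend : ∀ {m n} (f : ℕ → ℤ) → m ≤ n → (∀ i → m ≤ i → f i ≡ + 0) → sumLt m f ≡ sumLt n f
sumLt-extend {m} {n} f m≤n f≡0 = ≡.trans (≡.sym (extend (n ∸ m))) (≡.cong (λ k → sumLt k f) (ℕ.m+[n∸m]≡n m≤n))
  where
  extend : ∀ j → sumLt (m ℕ.+ j) f ≡ sumLt m f
  extend zero    = ≡.cong (λ k → sumLt k f) (ℕ.+-identityʳ m)
  extend (suc j) = ≡.trans (≡.cong (λ k → sumLt k f) (ℕ.+-suc m j))
    (≡.trans (≡.cong₂ ℤ._+_ (extend j) (f≡0 (m ℕ.+ j) (ℕ.m≤m+n m j))) (ℤ.+-identityʳ (sumLt m f)))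

-- The block comparison involves 8k terms of the sequence and 4k of the theta series. Neither excess
-- over k matters: `A i` ≥ i > N for the former, stability modulo x^(2N+1) for the latter.
lhsTr-theta₅ : ∀ {N k} → double N < k → lhsTr A k N ≡ even (theta 2 k) N
lhsTr-theta₅ {N} {k} 2N<k = begin
  lhsTr A k N                              ≡⟨ sumLt-extend _ k≤8k vanish ⟩
  lhsTr A (eightfold k) N                  ≡⟨ sequence-theta₅ N k ⟩
  theta 2 (double (double k)) (double N)   ≡⟨ coeff (theta-stable 2 (ℕ.<-≤-trans 2N<k k≤4k) 2N<k) (double N) ℕ.≤-refl ⟩
  theta 2 k (double N)                     ∎
  where
  open ≡.≡-Reasoning
  k≤4k : k ≤ double (double k)
  k≤4k = ℕ.≤-trans (double-≥ k) (double-≥ (double k))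
  k≤8k : k ≤ eightfold k
  k≤8k = ℕ.≤-trans k≤4k (double-≥ (double (double k)))
  vanish : ∀ i → k ≤ i → sgn i ℤ.* δ (A i) N ≡ + 0
  vanish i k≤i = ≡.trans (≡.cong (sgn i ℤ.*_) (δ-≢ (ℕ.>⇒≢ N<Ai))) (ℤ.*-zeroʳ (sgn i))
    where
    N<Ai : N < A i
    N<Ai = ℕ.≤-<-trans (double-≥ N) (ℕ.<-≤-trans 2N<k (ℕ.≤-trans k≤i (increasing-≥id A-increasing i)))

cancel₂ : ∀ {c ℓ} (R : CommutativeRing c ℓ) → let open CommutativeRing R in
  ∀ f {d e i j} → i * d ≈ 1# → j * e ≈ 1# → f * d * e * i * j ≈ f
cancel₂ R f {d} {e} {i} {j} id≈1 je≈1 = begin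
  f * d * e * i * j         ≈⟨ IntegerCoefficients.solve R 5 (λ f d e i j → f :*′ d :*′ e :*′ i :*′ j :=′ f :*′ (i :*′ d) :*′ (j :*′ e)) refl f d e i j ⟩
  f * (i * d) * (j * e)     ≈⟨ *-cong (trans (*-congˡ id≈1) (*-identityʳ f)) je≈1 ⟩
  f * 1#                    ≈⟨ *-identityʳ f ⟩
  f                         ∎
  where
  open CommutativeRing R
  open IntegerCoefficients R using () renaming (_:*_ to _:*′_; _:=_ to _:=′_)
  open SetoidReasoning setoid

pochInvTr-inverse : ∀ {N} a b k → 0 < a → pochInvTr a b k ⊛ pochTr a b k ≈[ N ] oneS
pochInvTr-inverse {N} a b k 0<a = ≡.subst₂ (λ f g → f ⊛ g ≈[ N ] oneS) (∏-finProd N _ k) (poch-pochTr N a b k) (pochInv-poch a b k 0<a)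
  where open Products (powers N)

theta₈-theta₅ : ∀ {N k} → double N < k → theta 5 k ≈[ N ] even (theta 2 k) ⊛ pochTr 1 5 k ⊛ pochTr 4 5 k
theta₈-theta₅ {N} {k} 2N<k = begin
  theta 5 k
    ≈⟨ coeffs (λ n n≤N → theta₈-theta₄ n k (ℕ.≤-<-trans (ℕ.≤-trans n≤N (double-≥ N)) 2N<k)) ⟩
  even (theta 1 (double k))
    ≈⟨ even-cong {f = theta 1 (double k)} {g = theta 1 k} (theta-stable 1 (ℕ.<-≤-trans 2N<k (double-≥ k)) 2N<k) ⟩
  even (theta 1 k)
    ≈⟨ even-cong {f = theta 1 k} {g = theta 2 k ⊛ pochTr 2 10 k ⊛ pochTr 8 10 k} (theta₄-theta₅ 2N<k) ⟩
  even (theta 2 k ⊛ pochTr 2 10 k ⊛ pochTr 8 10 k)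
    ≈⟨ even-⊛-pochTr (theta 2 k ⊛ pochTr 2 10 k) 4 5 8 10 k (λ i → ≡.trans
         (solve 1 (λ i → con 8 :+ con 10 :* i := (con 4 :+ con 5 :* i) :+ (con 4 :+ con 5 :* i)) ≡.refl i) (≡.sym (double-+ (4 ℕ.+ 5 ℕ.* i)))) ⟩
  even (theta 2 k ⊛ pochTr 2 10 k) ⊛ pochTr 4 5 k
    ≈⟨ ⊛-cong (even-⊛-pochTr (theta 2 k) 1 5 2 10 k (λ i → ≡.trans
         (solve 1 (λ i → con 2 :+ con 10 :* i := (con 1 :+ con 5 :* i) :+ (con 1 :+ con 5 :* i)) ≡.refl i) (≡.sym (double-+ (1 ℕ.+ 5 ℕ.* i))))) (refl {pochTr 4 5 k}) ⟩
  even (theta 2 k) ⊛ pochTr 1 5 k ⊛ pochTr 4 5 k ∎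
  where
  open CommutativeRing (seriesMod N) using (refl; setoid)
  open SetoidReasoning setoid

rhsTr-theta₅ : ∀ {N k} → double N < k → rhsTr k ≈[ N ] even (theta 2 k)
rhsTr-theta₅ {N} {k} 2N<k = begin
  -- For b = 8 the factors of `productTr` are, in this order, those of the numerator of `rhsTr`, so
  -- the first expression agrees by computation.
  productTr 5 k ⊛ pochInvTr 1 5 k ⊛ pochInvTr 4 5 k
    ≈⟨ ⊛-cong (⊛-cong (theta-product 5 (ℕ.≤-<-trans (double-≥ N) 2N<k)) (refl {pochInvTr 1 5 k})) (refl {pochInvTr 4 5 k}) ⟨
  theta 5 k ⊛ pochInvTr 1 5 k ⊛ pochInvTr 4 5 k
    ≈⟨ ⊛-cong (⊛-cong (theta₈-theta₅ 2N<k) (refl {pochInvTr 1 5 k})) (refl {pochInvTr 4 5 k}) ⟩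
  even (theta 2 k) ⊛ pochTr 1 5 k ⊛ pochTr 4 5 k ⊛ pochInvTr 1 5 k ⊛ pochInvTr 4 5 k
    ≈⟨ cancel₂ (seriesMod N) (even (theta 2 k)) {d = pochTr 1 5 k} {e = pochTr 4 5 k} {i = pochInvTr 1 5 k} {j = pochInvTr 4 5 k}
         (pochInvTr-inverse 1 5 k (s≤s z≤n)) (pochInvTr-inverse 4 5 k (s≤s z≤n)) ⟩
  even (theta 2 k) ∎
  where
  open CommutativeRing (seriesMod N) using (refl; setoid)
  open SetoidReasoning setoid

theorem7 : (a : ℕ → ℕ) → ListsIncreasing IsA a →
    (N : ℕ) → ∃ λ K → (k : ℕ) → k ≥ K → lhsTr a k N ≡ rhsTr k N
-- Coefficient N of the even part is coefficient 2N of Q_5, so more than 2N factors are required.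
theorem7 a lists N = suc (double N) , λ k 2N<k → begin
  lhsTr a k N          ≡⟨ sumLt-cong k (λ n _ → ≡.cong (λ m → sgn n ℤ.* δ m N) (enumeration-unique lists A-lists n)) ⟩
  lhsTr A k N          ≡⟨ lhsTr-theta₅ 2N<k ⟩
  even (theta 2 k) N   ≡⟨ coeff (rhsTr-theta₅ 2N<k) N ℕ.≤-refl ⟨
  rhsTr k N            ∎
  where open ≡.≡-Reasoning
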